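{- Let $s\ge1$ and $\mathbf{r}=(r_{1},\dots,r_{s})\in\mathbb{R}^{s}$. For $n\ge1$ define $$Q_{n}^{\mathbf{r}}(\underline{x}):=\frac{1}{n!}\sum_{\sigma\in S_{n}}\det(I_{n}-x_{1}M_{\sigma})^{r_{1}}\cdots\det(I_{n}-x_{s}M_{\sigma})^{r_{s}}\in\mathbb{R}\llbracket x_1,\dots,x_s\rrbracket,$$ and set $Q_0^{\mathbf{r}}(\underline{x}):=1$. Let $h(\underline{x}):=(1-x_{1})^{r_{1}}\cdots(1-x_{s})^{r_{s}}$. Then, for every $n\ge1$, as elements of $\mathbb{R}\llbracket x_1,\dots,x_s\rrbracket$, $$Q_{n}^{\mathbf{r}}(\underline{x})=\frac{1}{n}\sum_{k=1}^{n}h(\underline{x}^{k})\,Q_{n-k}^{\mathbf{r}}(\underline{x}).$$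
   Context: $S_n$ is the symmetric group on $n$ letters, $M_\sigma$ the $n\times n$ permutation matrix of $\sigma\in S_n$, $I_n$ the $n\times n$ identity matrix. Notation: $\underline{x}=(x_1,\dots,x_s)$ and $\underline{x}^k=(x_1^k,\dots,x_s^k)$, so $h(\underline{x}^k)=(1-x_1^k)^{r_1}\cdots(1-x_s^k)^{r_s}$. For a formal power series $1+u$ with $u$ of zero constant term and $a\in\mathbb{R}$, $(1+u)^a:=\sum_{m\ge0}\binom{a}{m}u^m$ with $\binom{a}{m}=\frac{a(a-1)\cdots(a-m+1)}{m!}$; this is applied to $\det(I_n-x_iM_\sigma)$, which has constant term $1$, and to $1-x_i$. -}

module Defs where

open import Algebra.Bundles using (CommutativeRing)
open import Algebra.Bundles.Raw using (RawRing)
import Algebra.Definitions.RawMonoid as RawMonoidDefs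
import Algebra.Definitions.RawSemiring as RawSemiringDefs
open import Algebra.Structures using (IsCommutativeRing)
open import Data.Bool.Base using (if_then_else_; _∧_)
open import Data.Fin.Base using (Fin; zero; suc; toℕ; punchIn)
open import Data.Fin.Permutation as Perm using (Permutation′; _⟨$⟩ʳ_; insert; remove; insert-remove)
import Data.Fin.Properties as Fin
open import Data.Integer.Base as ℤ using (1ℤ)
open import Data.List.Base using (List; []; _∷_; [_]; length; map; foldr; allFin; cartesianProductWith)
open import Data.List.Membership.Propositional.Properties using (∈-allFin)
open import Data.List.Properties using (length-tabulate; length-++; length-map)
open import Data.List.Relation.Unary.Any using (Any; here)
open import Data.List.Relation.Unary.Any.Properties using (cartesianProductWith⁺)
open import Data.Nat.Base as ℕ using (ℕ; zero; suc; NonZero; _∸_; _!; _⊔_)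
import Data.Nat.Properties as ℕ
open import Data.Product.Base using (∃-syntax; _×_; _,_)
open import Data.Rational.Base as ℚ using (ℚ; 0ℚ; 1ℚ; ½; _/_)
import Data.Rational.Properties as ℚ
open import Data.Rational.Solver using (module +-*-Solver)
open import Data.Vec.Base as Vec using (Vec; []; _∷_; replicate; zipWith; _[_]≔_)
open import Data.Vec.Properties using (≡-dec)
open import Function.Base using (id)
open import Level using (0ℓ)
open import Relation.Binary.PropositionalEquality using (_≡_; refl; sym; trans; cong; cong₂; subst)
open import Relation.Nullary.Decidable using (does)

------------------------------------------------------------------------
-- The real numbers, as Cauchy sequences of rationals up to null sequences

module _ where
  open import Data.Rational.Base using (_+_; _*_; -_; _-_; ∣_∣; _<_; Positive)

  IsCauchy : (ℕ → ℚ) → Set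
  IsCauchy x = ∀ ε → 0ℚ < ε → ∃[ N ] (∀ m n → N ℕ.≤ m → N ℕ.≤ n → ∣ x m - x n ∣ < ε)

  record ℝ : Set where
    constructor mkℝ
    field
      seq    : ℕ → ℚ
      cauchy : IsCauchy seq

  open ℝ public

  infix 4 _≃_
  _≃_ : ℝ → ℝ → Set
  x ≃ y = ∀ ε → 0ℚ < ε → ∃[ N ] (∀ n → N ℕ.≤ n → ∣ seq x n - seq y n ∣ < ε)

  private

    half-pos : ∀ {ε} → 0ℚ < ε → 0ℚ < ½ * ε
    half-pos {ε} 0<ε = subst (_< ½ * ε) (ℚ.*-zeroʳ ½) (ℚ.*-monoʳ-<-pos ½ 0<ε)

    half+half : ∀ ε → ½ * ε + ½ * ε ≡ ε
    half+half ε = trans (sym (ℚ.*-distribʳ-+ ε ½ ½)) (ℚ.*-identityˡ ε)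

    sum-close : ∀ {ε} a b → ∣ a ∣ < ½ * ε → ∣ b ∣ < ½ * ε → ∣ a + b ∣ < ε
    sum-close {ε} a b p q =
      ℚ.≤-<-trans (ℚ.∣p+q∣≤∣p∣+∣q∣ a b) (subst (∣ a ∣ + ∣ b ∣ <_) (half+half ε) (ℚ.+-mono-< p q))

    +-rearrange : ∀ a b c d → (a - c) + (b - d) ≡ (a + b) - (c + d)
    +-rearrange = solve 4 (λ a b c d → (a :- c) :+ (b :- d) := (a :+ b) :- (c :+ d)) refl
      where open +-*-Solver

    *-rearrange : ∀ a b c d → a * (b - d) + d * (a - c) ≡ a * b - c * d
    *-rearrange = solve 4 (λ a b c d → a :* (b :- d) :+ d :* (a :- c) := a :* b :- c :* d) refl
      where open +-*-Solver

    -‿rearrange : ∀ a b → - (a - b) ≡ - a - - b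
    -‿rearrange = solve 2 (λ a b → :- (a :- b) := (:- a) :- (:- b)) refl
      where open +-*-Solver

    telescope : ∀ a b c → (a - b) + (b - c) ≡ a - c
    telescope = solve 3 (λ a b c → (a :- b) :+ (b :- c) := a :- c) refl
      where open +-*-Solver

    swap-diff : ∀ a b → - (a - b) ≡ b - a
    swap-diff = solve 2 (λ a b → :- (a :- b) := b :- a) refl
      where open +-*-Solver

    restore : ∀ a b → b + (a - b) ≡ a
    restore = solve 2 (λ a b → b :+ (a :- b) := a) refl
      where open +-*-Solver

    +-close : ∀ {ε} a b c d → ∣ a - c ∣ < ½ * ε → ∣ b - d ∣ < ½ * ε → ∣ (a + b) - (c + d) ∣ < ε
    +-close a b c d p q = subst (λ z → ∣ z ∣ < _) (+-rearrange a b c d) (sum-close (a - c) (b - d) p q)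

    -‿close : ∀ {ε} a b → ∣ a - b ∣ < ε → ∣ - a - - b ∣ < ε
    -‿close a b = subst (_< _) (trans (sym (ℚ.∣-p∣≡∣p∣ (a - b))) (cong ∣_∣ (-‿rearrange a b)))

    diff-sym : ∀ {ε} a b → ∣ a - b ∣ < ε → ∣ b - a ∣ < ε
    diff-sym a b = subst (_< _) (trans (sym (ℚ.∣-p∣≡∣p∣ (a - b))) (cong ∣_∣ (swap-diff a b)))

    self-close : ∀ a {ε} → 0ℚ < ε → ∣ a - a ∣ < ε
    self-close a = subst (_< _) (sym (cong ∣_∣ (ℚ.+-inverseʳ a)))

    -- For a bound B > 0, every ε > 0 has a δ > 0 such that ∣a∣ < B and ∣b∣ < δ force ∣ab∣ < ε.
    product-small : ∀ B → 0ℚ < B → ∀ ε → 0ℚ < ε →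
      ∃[ δ ] (0ℚ < δ × (∀ a b → ∣ a ∣ < B → ∣ b ∣ < δ → ∣ a * b ∣ < ε))
    product-small B 0<B ε 0<ε = δ , 0<δ , small
      where
      instance
        B-pos : Positive B
        B-pos = ℚ.positive 0<B
        B-nonZero : ℚ.NonZero B
        B-nonZero = ℚ.pos⇒nonZero B
        B⁻¹-pos : Positive (ℚ.1/ B)
        B⁻¹-pos = ℚ.1/pos⇒pos B
      δ = ℚ.1/ B * ε
      0<δ : 0ℚ < δ
      0<δ = subst (_< δ) (ℚ.*-zeroʳ (ℚ.1/ B)) (ℚ.*-monoʳ-<-pos (ℚ.1/ B) 0<ε)
      Bδ≡ε : B * δ ≡ ε
      Bδ≡ε = trans (sym (ℚ.*-assoc B (ℚ.1/ B) ε))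
               (trans (cong (_* ε) (ℚ.*-inverseʳ B)) (ℚ.*-identityˡ ε))
      small : ∀ a b → ∣ a ∣ < B → ∣ b ∣ < δ → ∣ a * b ∣ < ε
      small a b ∣a∣<B ∣b∣<δ = begin-strict
        ∣ a * b ∣      ≡⟨ ℚ.∣p*q∣≡∣p∣*∣q∣ a b ⟩
        ∣ a ∣ * ∣ b ∣  ≤⟨ ℚ.*-monoʳ-≤-nonNeg ∣ b ∣ {{ℚ.∣-∣-nonNeg b}} (ℚ.<⇒≤ ∣a∣<B) ⟩
        B * ∣ b ∣      <⟨ ℚ.*-monoʳ-<-pos B ∣b∣<δ ⟩
        B * δ          ≡⟨ Bδ≡ε ⟩
        ε              ∎
        where open ℚ.≤-Reasoning

    *-close : ∀ {ε} a b c d → ∣ a * (b - d) ∣ < ½ * ε → ∣ d * (a - c) ∣ < ½ * ε → ∣ a * b - c * d ∣ < ε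
    *-close a b c d p q = subst (λ z → ∣ z ∣ < _) (*-rearrange a b c d) (sum-close (a * (b - d)) (d * (a - c)) p q)

    0<1 : 0ℚ < 1ℚ
    0<1 = ℚ.positive⁻¹ 1ℚ

    eventually-bounded : ∀ x → ∃[ N ] ∃[ B ] (0ℚ < B × (∀ n → N ℕ.≤ n → ∣ seq x n ∣ < B))
    eventually-bounded x with cauchy x 1ℚ 0<1
    ... | N , close = N , ∣ xN ∣ + 1ℚ , 0<B , bound
      where
      xN = seq x N
      0<B : 0ℚ < ∣ xN ∣ + 1ℚ
      0<B = ℚ.+-mono-≤-< (ℚ.0≤∣p∣ xN) 0<1
      bound : ∀ n → N ℕ.≤ n → ∣ seq x n ∣ < ∣ xN ∣ + 1ℚ
      bound n N≤n = begin-strict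
        ∣ seq x n ∣                ≡⟨ cong ∣_∣ (restore (seq x n) xN) ⟨
        ∣ xN + (seq x n - xN) ∣    ≤⟨ ℚ.∣p+q∣≤∣p∣+∣q∣ xN (seq x n - xN) ⟩
        ∣ xN ∣ + ∣ seq x n - xN ∣  <⟨ ℚ.+-monoʳ-< ∣ xN ∣ (close n N N≤n ℕ.≤-refl) ⟩
        ∣ xN ∣ + 1ℚ                ∎
        where open ℚ.≤-Reasoning

    ⊔-≤ˡ : ∀ {a b n} → a ⊔ b ℕ.≤ n → a ℕ.≤ n
    ⊔-≤ˡ {a} {b} = ℕ.≤-trans (ℕ.m≤m⊔n a b)

    ⊔-≤ʳ : ∀ {a b n} → a ⊔ b ℕ.≤ n → b ℕ.≤ n
    ⊔-≤ʳ {a} {b} = ℕ.≤-trans (ℕ.m≤n⊔m a b)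

  fromℚ : ℚ → ℝ
  fromℚ q = mkℝ (λ _ → q) (λ ε 0<ε → 0 , λ _ _ _ _ → self-close q 0<ε)

  infixl 6 _+ᴿ_
  _+ᴿ_ : ℝ → ℝ → ℝ
  x +ᴿ y = mkℝ (λ n → seq x n + seq y n) λ ε 0<ε →
    let M , p = cauchy x (½ * ε) (half-pos 0<ε)
        N , q = cauchy y (½ * ε) (half-pos 0<ε)
    in M ⊔ N , λ m n M≤m N≤n →
         +-close (seq x m) (seq y m) (seq x n) (seq y n)
           (p m n (⊔-≤ˡ M≤m) (⊔-≤ˡ N≤n)) (q m n (⊔-≤ʳ {M} M≤m) (⊔-≤ʳ {M} N≤n))

  infix 8 -ᴿ_
  -ᴿ_ : ℝ → ℝ
  -ᴿ x = mkℝ (λ n → - seq x n) λ ε 0<ε →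
    let N , p = cauchy x ε 0<ε
    in N , λ m n N≤m N≤n → -‿close (seq x m) (seq x n) (p m n N≤m N≤n)

  infixl 7 _*ᴿ_
  _*ᴿ_ : ℝ → ℝ → ℝ
  x *ᴿ y = mkℝ (λ n → seq x n * seq y n) λ ε 0<ε →
    let K , A , 0<A , ∣x∣<A = eventually-bounded x
        L , B , 0<B , ∣y∣<B = eventually-bounded y
        α , 0<α , smallʸ = product-small A 0<A (½ * ε) (half-pos 0<ε)
        β , 0<β , smallˣ = product-small B 0<B (½ * ε) (half-pos 0<ε)
        M , p = cauchy x β 0<β
        N , q = cauchy y α 0<α
    in (K ⊔ L) ⊔ (M ⊔ N) , λ m n ≤m ≤n →
         *-close (seq x m) (seq y m) (seq x n) (seq y n)
           (smallʸ (seq x m) (seq y m - seq y n)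
             (∣x∣<A m (⊔-≤ˡ {K} (⊔-≤ˡ ≤m)))
             (q m n (⊔-≤ʳ {M} (⊔-≤ʳ {K ⊔ L} ≤m)) (⊔-≤ʳ {M} (⊔-≤ʳ {K ⊔ L} ≤n))))
           (smallˣ (seq y n) (seq x m - seq x n)
             (∣y∣<B n (⊔-≤ʳ {K} (⊔-≤ˡ ≤n)))
             (p m n (⊔-≤ˡ {M} (⊔-≤ʳ {K ⊔ L} ≤m)) (⊔-≤ˡ {M} (⊔-≤ʳ {K ⊔ L} ≤n))))

  private

    pointwise : ∀ {x y} → (∀ n → seq x n ≡ seq y n) → x ≃ y
    pointwise {x} {y} eq ε 0<ε =
      0 , λ n _ → subst (λ z → ∣ seq x n - z ∣ < ε) (eq n) (self-close (seq x n) 0<ε)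

    +ᴿ-cong : ∀ {x y u v} → x ≃ y → u ≃ v → x +ᴿ u ≃ y +ᴿ v
    +ᴿ-cong {x} {y} {u} {v} x≃y u≃v ε 0<ε =
      let M , p = x≃y (½ * ε) (half-pos 0<ε)
          N , q = u≃v (½ * ε) (half-pos 0<ε)
      in M ⊔ N , λ n ≤n →
           +-close (seq x n) (seq u n) (seq y n) (seq v n) (p n (⊔-≤ˡ ≤n)) (q n (⊔-≤ʳ {M} ≤n))

    *ᴿ-cong : ∀ {x y u v} → x ≃ y → u ≃ v → x *ᴿ u ≃ y *ᴿ v
    *ᴿ-cong {x} {y} {u} {v} x≃y u≃v ε 0<ε =
      let K , A , 0<A , ∣x∣<A = eventually-bounded x
          L , B , 0<B , ∣v∣<B = eventually-bounded v
          α , 0<α , smallᵘ = product-small A 0<A (½ * ε) (half-pos 0<ε)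
          β , 0<β , smallˣ = product-small B 0<B (½ * ε) (half-pos 0<ε)
          M , p = x≃y β 0<β
          N , q = u≃v α 0<α
      in (K ⊔ L) ⊔ (M ⊔ N) , λ n ≤n →
           *-close (seq x n) (seq u n) (seq y n) (seq v n)
             (smallᵘ (seq x n) (seq u n - seq v n)
               (∣x∣<A n (⊔-≤ˡ {K} (⊔-≤ˡ ≤n))) (q n (⊔-≤ʳ {M} (⊔-≤ʳ {K ⊔ L} ≤n))))
             (smallˣ (seq v n) (seq x n - seq y n)
               (∣v∣<B n (⊔-≤ʳ {K} (⊔-≤ˡ ≤n))) (p n (⊔-≤ˡ {M} (⊔-≤ʳ {K ⊔ L} ≤n))))

    -ᴿ-cong : ∀ {x y} → x ≃ y → -ᴿ x ≃ -ᴿ y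
    -ᴿ-cong {x} {y} x≃y ε 0<ε =
      let N , p = x≃y ε 0<ε in N , λ n ≤n → -‿close (seq x n) (seq y n) (p n ≤n)

    ≃-sym : ∀ {x y} → x ≃ y → y ≃ x
    ≃-sym {x} {y} x≃y ε 0<ε =
      let N , p = x≃y ε 0<ε in N , λ n ≤n → diff-sym (seq x n) (seq y n) (p n ≤n)

    ≃-trans : ∀ {x y z} → x ≃ y → y ≃ z → x ≃ z
    ≃-trans {x} {y} {z} x≃y y≃z ε 0<ε =
      let M , p = x≃y (½ * ε) (half-pos 0<ε)
          N , q = y≃z (½ * ε) (half-pos 0<ε)
      in M ⊔ N , λ n ≤n →
           subst (λ w → ∣ w ∣ < ε) (telescope (seq x n) (seq y n) (seq z n))
             (sum-close (seq x n - seq y n) (seq y n - seq z n) (p n (⊔-≤ˡ ≤n)) (q n (⊔-≤ʳ {M} ≤n)))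

  ℝ-isCommutativeRing : IsCommutativeRing _≃_ _+ᴿ_ _*ᴿ_ -ᴿ_ (fromℚ 0ℚ) (fromℚ 1ℚ)
  ℝ-isCommutativeRing = record
    { isRing = record
      { +-isAbelianGroup = record
        { isGroup = record
          { isMonoid = record
            { isSemigroup = record
              { isMagma = record
                { isEquivalence = record
                  { refl  = λ {x} → pointwise {x} {x} λ _ → refl
                  ; sym   = λ {x} {y} → ≃-sym {x} {y}
                  ; trans = λ {x} {y} {z} → ≃-trans {x} {y} {z}
                  }
                ; ∙-cong = λ {x} {y} {u} {v} → +ᴿ-cong {x} {y} {u} {v}
                }
              ; assoc = λ x y z → pointwise {(x +ᴿ y) +ᴿ z} {x +ᴿ (y +ᴿ z)} λ n →
                  ℚ.+-assoc (seq x n) (seq y n) (seq z n)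
              }
            ; identity = (λ x → pointwise {fromℚ 0ℚ +ᴿ x} {x} λ n → ℚ.+-identityˡ (seq x n))
                       , (λ x → pointwise {x +ᴿ fromℚ 0ℚ} {x} λ n → ℚ.+-identityʳ (seq x n))
            }
          ; inverse = (λ x → pointwise {(-ᴿ x) +ᴿ x} {fromℚ 0ℚ} λ n → ℚ.+-inverseˡ (seq x n))
                    , (λ x → pointwise {x +ᴿ (-ᴿ x)} {fromℚ 0ℚ} λ n → ℚ.+-inverseʳ (seq x n))
          ; ⁻¹-cong = λ {x} {y} → -ᴿ-cong {x} {y}
          }
        ; comm = λ x y → pointwise {x +ᴿ y} {y +ᴿ x} λ n → ℚ.+-comm (seq x n) (seq y n)
        }
      ; *-cong = λ {x} {y} {u} {v} → *ᴿ-cong {x} {y} {u} {v}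
      ; *-assoc = λ x y z → pointwise {(x *ᴿ y) *ᴿ z} {x *ᴿ (y *ᴿ z)} λ n →
          ℚ.*-assoc (seq x n) (seq y n) (seq z n)
      ; *-identity = (λ x → pointwise {fromℚ 1ℚ *ᴿ x} {x} λ n → ℚ.*-identityˡ (seq x n))
                   , (λ x → pointwise {x *ᴿ fromℚ 1ℚ} {x} λ n → ℚ.*-identityʳ (seq x n))
      ; distrib = (λ x y z → pointwise {x *ᴿ (y +ᴿ z)} {x *ᴿ y +ᴿ x *ᴿ z} λ n →
                     ℚ.*-distribˡ-+ (seq x n) (seq y n) (seq z n))
                , (λ x y z → pointwise {(y +ᴿ z) *ᴿ x} {y *ᴿ x +ᴿ z *ᴿ x} λ n →
                     ℚ.*-distribʳ-+ (seq x n) (seq y n) (seq z n))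
      }
    ; *-comm = λ x y → pointwise {x *ᴿ y} {y *ᴿ x} λ n → ℚ.*-comm (seq x n) (seq y n)
    }

  ℝ-commutativeRing : CommutativeRing 0ℓ 0ℓ
  ℝ-commutativeRing = record { isCommutativeRing = ℝ-isCommutativeRing }

------------------------------------------------------------------------
-- The symmetric group

-- Each permutation of Fin (suc n) is given by the image i of zero and a
-- permutation of the remaining elements.  permutations-complete and
-- length-permutations together show that every element of Sₙ (up to pointwise
-- equality) is listed exactly once.
permutations : ∀ n → List (Permutation′ n)
permutations zero    = [ Perm.id ]
permutations (suc n) = cartesianProductWith (insert zero) (allFin (suc n)) (permutations n)

private

  insert-cong : ∀ {n} (i : Fin (suc n)) {π ρ : Permutation′ n} → π Perm.≈ ρ → insert zero i π Perm.≈ insert zero i ρ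
  insert-cong i π≈ρ zero    = refl
  insert-cong i π≈ρ (suc k) = cong (punchIn i) (π≈ρ k)

  length-cartesianProductWith : ∀ {A B C : Set} (f : A → B → C) xs ys →
    length (cartesianProductWith f xs ys) ≡ length xs ℕ.* length ys
  length-cartesianProductWith f []       ys = refl
  length-cartesianProductWith f (x ∷ xs) ys =
    trans (length-++ (map (f x) ys)) (cong₂ ℕ._+_ (length-map (f x) ys) (length-cartesianProductWith f xs ys))

permutations-complete : ∀ n (π : Permutation′ n) → Any (π Perm.≈_) (permutations n)
permutations-complete zero    π = here λ ()
permutations-complete (suc n) π =
  cartesianProductWith⁺ (insert zero)
    (λ { refl π′≈ρ k → trans (sym (insert-remove zero π k)) (insert-cong (π ⟨$⟩ʳ zero) {remove zero π} π′≈ρ k) })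
    (∈-allFin (π ⟨$⟩ʳ zero)) (permutations-complete n (remove zero π))

length-permutations : ∀ n → length (permutations n) ≡ n !
length-permutations zero    = refl
length-permutations (suc n) =
  trans (length-cartesianProductWith (insert zero) (allFin (suc n)) (permutations n))
        (cong₂ ℕ._*_ (length-tabulate {n = suc n} id) (length-permutations n))

------------------------------------------------------------------------
-- Matrices

module Matrices {c ℓ} (R : RawRing c ℓ) where
  open RawRing R

  ∑ ∏ : ∀ {n} → (Fin n → Carrier) → Carrier
  ∑ = RawMonoidDefs.sum +-rawMonoid
  ∏ = RawMonoidDefs.sum *-rawMonoid

  ∑S : ∀ n → (Permutation′ n → Carrier) → Carrier
  ∑S n f = foldr _+_ 0# (map f (permutations n))

  Matrix : ℕ → Set c
  Matrix n = Fin n → Fin n → Carrier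

  identityMatrix : ∀ {n} → Matrix n
  identityMatrix i j = if does (i Fin.≟ j) then 1# else 0#

  -- Column j of M_σ is the standard basis vector e_{σ(j)}.
  permutationMatrix : ∀ {n} → Permutation′ n → Matrix n
  permutationMatrix σ i j = if does (i Fin.≟ (σ ⟨$⟩ʳ j)) then 1# else 0#

  -- A factor -1 for every inversion i < j, τ(j) < τ(i).
  sgn : ∀ {n} → Permutation′ n → Carrier
  sgn τ = ∏ λ i → ∏ λ j →
    if does (i Fin.<? j) ∧ does ((τ ⟨$⟩ʳ j) Fin.<? (τ ⟨$⟩ʳ i)) then - 1# else 1#

  det : ∀ {n} → Matrix n → Carrier
  det {n} A = ∑S n λ τ → sgn τ * ∏ λ i → A i (τ ⟨$⟩ʳ i)

------------------------------------------------------------------------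
-- Formal power series in s variables

recip : (n : ℕ) .{{_ : NonZero n}} → ℚ
recip n = 1ℤ / n

-- ι is the structure map of R as a ℚ-algebra.
module PowerSeries {c ℓ} (R : RawRing c ℓ) (ι : ℚ → RawRing.Carrier R) (s : ℕ) where
  private
    module R = RawRing R
    module RM = Matrices R

  -- A series is its family of coefficients, indexed by exponent vectors.
  Series : Set c
  Series = Vec ℕ s → R.Carrier

  -- ∑≤ e f is the sum of f a over all exponent vectors a ≤ e componentwise.
  ∑≤ : ∀ {k} → Vec ℕ k → (Vec ℕ k → R.Carrier) → R.Carrier
  ∑≤ []      f = f []
  ∑≤ (n ∷ e) f = RM.∑ {suc n} λ i → ∑≤ e λ a → f (toℕ i ∷ a)

  monomial : Vec ℕ s → Series
  monomial a e = if does (≡-dec ℕ._≟_ a e) then R.1# else R.0#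

  seriesRing : RawRing c ℓ
  seriesRing = record
    { Carrier = Series
    ; _≈_     = λ f g → ∀ e → f e R.≈ g e
    ; _+_     = λ f g e → f e R.+ g e
    ; _*_     = λ f g e → ∑≤ e λ a → f a R.* g (zipWith _∸_ e a)
    ; -_      = λ f e → R.- f e
    ; 0#      = λ _ → R.0#
    ; 1#      = monomial (replicate s 0)
    }

  open RawRing seriesRing public using (_≈_; _+_; _*_; -_; 0#; 1#)
  open RawSemiringDefs (RawRing.rawSemiring seriesRing) public using (_^_)
  open Matrices seriesRing public

  infixl 6 _-_
  _-_ : Series → Series → Series
  f - g = f + (- g)

  infixr 7 _·_
  _·_ : R.Carrier → Series → Series
  (c · f) e = c R.* f e

  X : Fin s → Series
  X i = monomial (replicate s 0 [ i ]≔ 1)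

  recip! : ℕ → ℚ
  recip! m = recip (m !) {{m ℕ.!≢0}}

  falling : R.Carrier → ℕ → R.Carrier
  falling a zero    = R.1#
  falling a (suc m) = falling a m R.* (a R.+ R.- ι ((ℤ.+ m) / 1))

  binom : R.Carrier → ℕ → R.Carrier
  binom a m = falling a m R.* ι (recip! m)

  -- f ^ᴿ a = ∑_{m≥0} binom a m · u ^ m where u = f - 1, for f with constant
  -- coefficient 1.  As u ^ m then has no term of total degree below m, the
  -- coefficient at e only receives contributions from m ≤ ∣e∣.
  infixr 8 _^ᴿ_
  _^ᴿ_ : Series → R.Carrier → Series
  (f ^ᴿ a) e = RM.∑ {suc (Vec.sum e)} λ m → binom a (toℕ m) R.* ((f - 1#) ^ toℕ m) e

  h : (Fin s → R.Carrier) → (Fin s → Series) → Series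
  h r y = ∏ λ i → (1# - y i) ^ᴿ r i

  Q : (Fin s → R.Carrier) → ℕ → Series
  Q r zero      = 1#
  Q r n@(suc _) = ι (recip! n) ·
    ∑S n λ σ → ∏ λ i → det (λ j k → identityMatrix j k - X i * permutationMatrix σ j k) ^ᴿ r i

module RealSeries = PowerSeries (CommutativeRing.rawRing ℝ-commutativeRing) fromℚ

-- Give the element j of Fin n a weight w_j ≥ 1 and σ ∈ Sₙ the product over i of
-- det(I - M_σ diag(x_i^w_j))^r_i.  If 0 is a fixed point, the determinant has the
-- factor 1 - x_i^w_0; otherwise it does not change when 0 is deleted from its
-- cycle and w_0 is added to the weight of the predecessor of 0.  So the sum S(w)
-- over all σ satisfies
--   S(a ∷ w) = h(x^a) S(w) + ∑_j S(w with a added to w_j),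
-- which forces S to be symmetric in the weights.  Hence, for m + 1 elements,
--   S(a, 1, …, 1) = h(x^a) S(1^m) + m S(a + 1, 1, …, 1),
-- and iterating from a = 1, where S(1^n) = n! Q_n, gives the recursion.
-- The rule (fg)^r = f^r g^r holds because f^r is the only solution y with constant
-- term 1 of f E y = r y E f, where E is the Euler derivation.

module Submission where

open import Defs
open import Algebra.Bundles using (CommutativeRing)
import Algebra.Properties.CommutativeMonoid.Sum as CommutativeMonoidSum
import Algebra.Properties.CommutativeSemigroup as CommutativeSemigroupProperties
import Algebra.Properties.Ring as RingProperties
import Algebra.Properties.Semiring.Exp as SemiringExp
import Algebra.Properties.Semiring.Mult as SemiringMult
import Algebra.Properties.Semiring.Sum as SemiringSum
import Algebra.Solver.Ring.NaturalCoefficients.Default as SemiringSolver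
open import Algebra.Structures using (IsCommutativeRing)
open import Data.Bool.Base using (Bool; if_then_else_; _∧_)
open import Data.Empty using (⊥-elim)
open import Data.Fin.Base using (Fin; zero; suc; toℕ; punchIn; pinch)
open import Data.Fin.Permutation as Perm using (Permutation′; _⟨$⟩ʳ_; _⟨$⟩ˡ_; _∘ₚ_; insert; remove)
import Data.Fin.Properties as Fin
import Data.Integer.Base as ℤ
import Data.Integer.Properties as ℤ
open import Data.List.Base as List using (List; []; _∷_; foldr; map; tabulate; cartesianProductWith)
open import Data.Nat.Base as ℕ using (ℕ; zero; suc; _∸_; _!; NonZero)
import Data.Nat.Properties as ℕ
open import Data.Product.Base using (_,_)
open import Data.Rational.Base as ℚ using (ℚ; 0ℚ; 1ℚ; fromℚᵘ)
import Data.Rational.Properties as ℚ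
open import Data.Rational.Unnormalised.Base as ℚᵘ using (mkℚᵘ; *≡*)
import Data.Rational.Unnormalised.Properties as ℚᵘ
open import Data.Vec.Base as Vec using (Vec; []; _∷_; replicate; zipWith; lookup; insertAt; updateAt; _[_]≔_)
import Data.Vec.Functional as Vector
open import Data.Vec.Functional using (Vector; removeAt)
open import Data.Vec.Functional.Properties using (insertAt-lookup; insertAt-punchIn)
open import Data.Vec.Properties using (≡-dec; lookup-replicate; lookup∘updateAt; lookup∘updateAt′)
open import Function.Base using (_∘_; id)
open import Level using (_⊔_) renaming (suc to lsuc)
open import Relation.Binary.PropositionalEquality as ≡ using (_≡_; _≢_; _≗_)
import Relation.Binary.Reasoning.Setoid as SetoidReasoning
open import Relation.Nullary.Decidable using (does; yes; no)
open import Relation.Nullary.Negation using (contradiction)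

-- Cycle decompositions never occur. The sum over S_n is split by the image of 0, as `permutations`
-- lists it, and a cycle is consumed one element at a time. The weights remember the consumed
-- elements, which is why every element gets its own power of x_i. After one step the grown weight
-- can sit at any remaining position; symmetry brings it back to the front, so the recursion closes
-- on vectors with a single large entry. That symmetry is proved for the function `T` defined by the
-- recursion alone, where it is an identity of finite sums, not for determinants. A real power is
-- given coefficient by coefficient, with a cutoff depending on the exponent vector. Its
-- differential equation is therefore treated modulo each degree, where a partial sum solves it.
-- Uniqueness divides by the degree, hence the coefficients form a ℚ-algebra. Working over arbitrary
-- commutative rings lets the determinant lemmas serve twice: for series, and for series with
-- equality of constant terms, where they show that the determinants have constant term 1.

-- Sums over the symmetric group

module SymmetricGroupSums {c ℓ} (A : CommutativeRing c ℓ) where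
  open CommutativeRing A hiding (zero)
  open Matrices rawRing
  open SemiringSum semiring using (sum-cong-≋; sum-permute)
  open SetoidReasoning setoid

  private
    total : ∀ {a} {B : Set a} → (B → Carrier) → List B → Carrier
    total f xs = foldr _+_ 0# (map f xs)

    total-++ : ∀ {a} {B : Set a} (f : B → Carrier) xs ys → total f (xs List.++ ys) ≈ total f xs + total f ys
    total-++ f []       ys = sym (+-identityˡ _)
    total-++ f (x ∷ xs) ys = trans (+-congˡ (total-++ f xs ys)) (sym (+-assoc _ _ _))

    total-map : ∀ {a b} {B : Set a} {C : Set b} (f : C → Carrier) (g : B → C) xs → total f (map g xs) ≈ total (f ∘ g) xs
    total-map f g []       = refl
    total-map f g (x ∷ xs) = +-congˡ (total-map f g xs)

    total-cartesianProductWith : ∀ {B C D : Set} (f : D → Carrier) (g : B → C → D) {n} (h : Fin n → B) ys →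
      total f (cartesianProductWith g (tabulate h) ys) ≈ ∑ λ i → total (f ∘ g (h i)) ys
    total-cartesianProductWith f g {zero}  h ys = refl
    total-cartesianProductWith f g {suc n} h ys =
      trans (total-++ f (map (g (h zero)) ys) _)
        (+-cong (total-map f (g (h zero)) ys) (total-cartesianProductWith f g (h ∘ suc) ys))

    total-cong : ∀ {B : Set} {f g : B → Carrier} xs → (∀ x → f x ≈ g x) → total f xs ≈ total g xs
    total-cong []       f≈g = refl
    total-cong (x ∷ xs) f≈g = +-cong (f≈g x) (total-cong xs f≈g)

    total-+ : ∀ {B : Set} (f g : B → Carrier) xs → total (λ x → f x + g x) xs ≈ total f xs + total g xs
    total-+ f g []       = sym (+-identityˡ 0#)
    total-+ f g (x ∷ xs) = trans (+-congˡ (total-+ f g xs)) (interchange (f x) (g x) _ _)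
      where
      open SemiringSolver commutativeSemiring
      interchange : ∀ a b c d → (a + b) + (c + d) ≈ (a + c) + (b + d)
      interchange = solve 4 (λ a b c d → (a :+ b) :+ (c :+ d) := (a :+ c) :+ (b :+ d)) refl

    total-0 : ∀ {B : Set} (xs : List B) → total (λ _ → 0#) xs ≈ 0#
    total-0 []       = refl
    total-0 (x ∷ xs) = trans (+-identityˡ _) (total-0 xs)

    total-*ˡ : ∀ {B : Set} c (f : B → Carrier) xs → c * total f xs ≈ total (λ x → c * f x) xs
    total-*ˡ c f []       = zeroʳ c
    total-*ˡ c f (x ∷ xs) = trans (distribˡ c _ _) (+-congˡ (total-*ˡ c f xs))

    total-∑ : ∀ {B : Set} {n} (f : Fin n → B → Carrier) xs → total (λ x → ∑ λ i → f i x) xs ≈ ∑ λ i → total (f i) xs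
    total-∑ {n = zero}  f xs = total-0 xs
    total-∑ {n = suc n} f xs = trans (total-+ (f zero) _ xs) (+-congˡ (total-∑ (f ∘ suc) xs))

  ∑S-cong : ∀ n {f g : Permutation′ n → Carrier} → (∀ π → f π ≈ g π) → ∑S n f ≈ ∑S n g
  ∑S-cong n = total-cong (permutations n)

  ∑S-*ˡ : ∀ n c (f : Permutation′ n → Carrier) → c * ∑S n f ≈ ∑S n (λ π → c * f π)
  ∑S-*ˡ n c f = total-*ˡ c f (permutations n)

  ∑S-∑ : ∀ n {m} (f : Fin m → Permutation′ n → Carrier) → ∑S n (λ π → ∑ λ i → f i π) ≈ ∑ λ i → ∑S n (f i)
  ∑S-∑ n f = total-∑ f (permutations n)

  ∑S-suc : ∀ n (f : Permutation′ (suc n) → Carrier) → ∑S (suc n) f ≈ ∑ λ i → ∑S n (f ∘ insert zero i)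
  ∑S-suc n f = total-cartesianProductWith f (insert zero) id (permutations n)

  -- The list of permutations is complete only up to pointwise equality, so reindexing a sum
  -- requires summands that respect it.
  Extensional : ∀ {n} → (Permutation′ n → Carrier) → Set _
  Extensional f = ∀ π ρ → π Perm.≈ ρ → f π ≈ f ρ

  insert-∘ₚ : ∀ {n} (c : Permutation′ (suc n)) i (π : Permutation′ n) →
    (insert zero i π ∘ₚ c) Perm.≈ insert zero (c ⟨$⟩ʳ i) (π ∘ₚ remove i c)
  insert-∘ₚ c i π zero    = ≡.refl
  insert-∘ₚ c i π (suc k) = Perm.punchIn-permute c i (π ⟨$⟩ʳ k)

  insert-cong : ∀ {n} (i : Fin (suc n)) {π ρ : Permutation′ n} → π Perm.≈ ρ → insert zero i π Perm.≈ insert zero i ρ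
  insert-cong i π≈ρ zero    = ≡.refl
  insert-cong i π≈ρ (suc k) = ≡.cong (punchIn i) (π≈ρ k)

  -- Composing with c carries the block of permutations with 0 ↦ i to the block with 0 ↦ c(i), and
  -- acts inside it as translation by `remove i c`. Induction settles each block, and c permutes the
  -- blocks.
  ∑S-translate : ∀ n (f : Permutation′ n → Carrier) → Extensional f → ∀ c → ∑S n (λ π → f (π ∘ₚ c)) ≈ ∑S n f
  ∑S-translate zero    f ext c = +-congʳ (ext _ _ λ ())
  ∑S-translate (suc n) f ext c = begin
    ∑S (suc n) (λ π → f (π ∘ₚ c))
      ≈⟨ ∑S-suc n _ ⟩
    ∑ (λ i → ∑S n (λ π → f (insert zero i π ∘ₚ c)))
      ≈⟨ sum-cong-≋ (λ i → ∑S-cong n λ π →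
           ext (insert zero i π ∘ₚ c) (insert zero (c ⟨$⟩ʳ i) (π ∘ₚ remove i c)) (insert-∘ₚ c i π)) ⟩
    ∑ (λ i → ∑S n (λ π → f (insert zero (c ⟨$⟩ʳ i) (π ∘ₚ remove i c))))
      ≈⟨ sum-cong-≋ (λ i → ∑S-translate n (f ∘ insert zero (c ⟨$⟩ʳ i))
           (λ π ρ π≈ρ → ext _ _ (insert-cong (c ⟨$⟩ʳ i) {π} {ρ} π≈ρ)) (remove i c)) ⟩
    ∑ (λ i → ∑S n (f ∘ insert zero (c ⟨$⟩ʳ i)))
      ≈⟨ sum-permute (λ i → ∑S n (f ∘ insert zero i)) c ⟨
    ∑ (λ i → ∑S n (f ∘ insert zero i))
      ≈⟨ ∑S-suc n f ⟨
    ∑S (suc n) f ∎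

-- Determinants of I - M_σ diag(y) and deletion of an element from its cycle

module Determinants {c ℓ} (A : CommutativeRing c ℓ) where
  open CommutativeRing A hiding (zero)
  open RingProperties ring
  open SemiringExp semiring using (_^_)
  open Matrices rawRing
  open SymmetricGroupSums A
  open SemiringSum semiring using (sum-cong-≋; sum-remove; ∑-distrib-+; *-distribˡ-sum; sum-replicate-zero)
  private
    module ∏ = CommutativeMonoidSum *-commutativeMonoid
    module Solver = SemiringSolver commutativeSemiring
  open SetoidReasoning setoid

  sign : ℕ → Carrier
  sign n = (- 1#) ^ n

  sign-2+ : ∀ n → sign (suc (suc n)) ≈ sign n
  sign-2+ n = trans (sym (*-assoc _ _ _)) (trans (*-congʳ (trans (-1*x≈-x (- 1#)) (-‿involutive 1#))) (*-identityˡ _))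

  private
    factor : Bool → Carrier
    factor b = if b then - 1# else 1#

    <?-punchIn : ∀ {n} (i : Fin (suc n)) (a b : Fin n) → does (punchIn i a Fin.<? punchIn i b) ≡ does (a Fin.<? b)
    <?-punchIn zero    a       b       = ≡.refl
    <?-punchIn (suc i) zero    zero    = ≡.refl
    <?-punchIn (suc i) zero    (suc b) = ≡.refl
    <?-punchIn (suc i) (suc a) zero    = ≡.refl
    <?-punchIn (suc i) (suc a) (suc b) = <?-punchIn i a b

    sign-∏ : ∀ {n} (i : Fin (suc n)) → ∏ (λ k → factor (does (punchIn i k Fin.<? i))) ≈ sign (toℕ i)
    sign-∏ {n}     zero    = ∏.sum-replicate-zero n
    sign-∏ {suc n} (suc i) = *-congˡ (sign-∏ i)

  -- The inversions involving position 0 correspond to the values below i, of which there are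
  -- `toℕ i`; `π` only reorders these factors. All other inversions are those of `π`, because
  -- `punchIn i` preserves order.
  sgn-insert : ∀ {n} (i : Fin (suc n)) (π : Permutation′ n) → sgn (insert zero i π) ≈ sign (toℕ i) * sgn π
  sgn-insert {n} i π = *-cong
    (begin
      1# * ∏ (λ k → factor (does (punchIn i (π ⟨$⟩ʳ k) Fin.<? i)))  ≈⟨ *-identityˡ _ ⟩
      ∏ (λ k → factor (does (punchIn i (π ⟨$⟩ʳ k) Fin.<? i)))       ≈⟨ ∏.sum-permute (λ k → factor (does (punchIn i k Fin.<? i))) π ⟨
      ∏ (λ k → factor (does (punchIn i k Fin.<? i)))                ≈⟨ sign-∏ i ⟩
      sign (toℕ i)                                                  ∎)
    (∏.sum-cong-≋ λ a → trans (*-identityˡ _) (reflexive (∏.sum-cong-≗ λ b →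
      ≡.cong (λ z → factor (does (a Fin.<? b) ∧ z)) (<?-punchIn i (π ⟨$⟩ʳ b) (π ⟨$⟩ʳ a)))))

  det-cong : ∀ {n} {M N : Matrix n} → (∀ i j → M i j ≈ N i j) → det M ≈ det N
  det-cong {n} M≈N = ∑S-cong n λ τ → *-congˡ (∏.sum-cong-≋ λ i → M≈N i (τ ⟨$⟩ʳ i))

  minor : ∀ {n} → Matrix (suc n) → Fin (suc n) → Matrix n
  minor M j i = removeAt (M (suc i)) j

  det-laplace : ∀ {n} (M : Matrix (suc n)) → det M ≈ ∑ λ j → sign (toℕ j) * (M zero j * det (minor M j))
  det-laplace {n} M = trans (∑S-suc n _) (sum-cong-≋ λ j → begin
    ∑S n (λ π → sgn (insert zero j π) * (M zero j * ∏ λ i → minor M j i (π ⟨$⟩ʳ i)))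
      ≈⟨ ∑S-cong n (λ π → trans (*-congʳ (sgn-insert j π)) (regroup _ _ _ _)) ⟩
    ∑S n (λ π → (sign (toℕ j) * M zero j) * (sgn π * ∏ λ i → minor M j i (π ⟨$⟩ʳ i)))
      ≈⟨ ∑S-*ˡ n _ _ ⟨
    (sign (toℕ j) * M zero j) * det (minor M j)
      ≈⟨ *-assoc _ _ _ ⟩
    sign (toℕ j) * (M zero j * det (minor M j)) ∎)
    where
    open Solver
    regroup : ∀ a b c d → (a * b) * (c * d) ≈ (a * c) * (b * d)
    regroup = solve 4 (λ a b c d → (a :* b) :* (c :* d) := (a :* c) :* (b :* d)) refl

  infixr 5 _◂_
  _◂_ : ∀ {n} → Vector Carrier (suc n) → (Fin (suc n) → Vector Carrier n) → Matrix (suc n)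
  (u ◂ C) i = u i Vector.∷ C i

  det-◂ : ∀ {n} (u : Vector Carrier (suc n)) C →
    det (u ◂ C) ≈ u zero * det (C ∘ suc) + ∑ λ k → sign (suc (toℕ k)) * (C zero k * det (minor (u ◂ C) (suc k)))
  det-◂ u C = trans (det-laplace (u ◂ C)) (+-congʳ (*-identityˡ _))

  private
    minor-◂ : ∀ {n} (u : Vector Carrier (suc (suc n))) C k i j →
      minor (u ◂ C) (suc k) i j ≡ (u ∘ suc ◂ λ i → removeAt (C (suc i)) k) i j
    minor-◂ u C k i zero    = ≡.refl
    minor-◂ u C k i (suc j) = ≡.refl

  -- Expansion along the first row preserves the shape: every minor other than the one for column 0
  -- again has the distinguished column in front, so induction applies to it.
  det-◂-linear : ∀ {n} x (u v : Vector Carrier (suc n)) C →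
    det ((λ i → u i + x * v i) ◂ C) ≈ det (u ◂ C) + x * det (v ◂ C)
  det-◂-linear {zero} x u v C =
    trans (det-◂ (λ i → u i + x * v i) C) (trans (lemma _ x _ _) (sym (+-cong (det-◂ u C) (*-congˡ (det-◂ v C)))))
    where
    open Solver
    lemma : ∀ a x b d → (a + x * b) * d + 0# ≈ (a * d + 0#) + x * (b * d + 0#)
    lemma = solve 4 (λ a x b d → (a :+ x :* b) :* d :+ con 0 := (a :* d :+ con 0) :+ x :* (b :* d :+ con 0)) refl
  det-◂-linear {suc n} x u v C = begin
    det (w ◂ C)
      ≈⟨ det-◂ w C ⟩
    w zero * D + ∑ (λ k → term w k)
      ≈⟨ +-congˡ (sum-cong-≋ λ k → begin
           term w k
             ≈⟨ *-congˡ (*-congˡ (begin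
                  det (minor (w ◂ C) (suc k))
                    ≈⟨ det-cong (λ i j → reflexive (minor-◂ w C k i j)) ⟩
                  det (w ∘ suc ◂ C′ k)
                    ≈⟨ det-◂-linear x (u ∘ suc) (v ∘ suc) (C′ k) ⟩
                  det (u ∘ suc ◂ C′ k) + x * det (v ∘ suc ◂ C′ k)
                    ≈⟨ +-cong (det-cong (λ i j → reflexive (minor-◂ u C k i j)))
                              (*-congˡ (det-cong (λ i j → reflexive (minor-◂ v C k i j)))) ⟨
                  det (minor (u ◂ C) (suc k)) + x * det (minor (v ◂ C) (suc k)) ∎)) ⟩
           sign (suc (toℕ k)) * (C zero k * (det (minor (u ◂ C) (suc k)) + x * det (minor (v ◂ C) (suc k))))
             ≈⟨ distribute _ _ _ _ _ ⟩
           term u k + x * term v k ∎) ⟩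
    w zero * D + ∑ (λ k → term u k + x * term v k)
      ≈⟨ +-congˡ (trans (∑-distrib-+ (term u) (λ k → x * term v k)) (+-congˡ (sym (*-distribˡ-sum x (term v))))) ⟩
    w zero * D + (∑ (term u) + x * ∑ (term v))
      ≈⟨ collect _ _ _ _ _ _ ⟩
    (u zero * D + ∑ (term u)) + x * (v zero * D + ∑ (term v))
      ≈⟨ +-cong (det-◂ u C) (*-congˡ (det-◂ v C)) ⟨
    det (u ◂ C) + x * det (v ◂ C) ∎
    where
    w : Vector Carrier (suc (suc n))
    w i = u i + x * v i
    D = det (C ∘ suc)
    C′ : Fin (suc n) → Fin (suc n) → Vector Carrier n
    C′ k i = removeAt (C (suc i)) k
    term : Vector Carrier (suc (suc n)) → Fin (suc n) → Carrier
    term u k = sign (suc (toℕ k)) * (C zero k * det (minor (u ◂ C) (suc k)))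
    open Solver
    distribute : ∀ s a x p q → s * (a * (p + x * q)) ≈ s * (a * p) + x * (s * (a * q))
    distribute = solve 5 (λ s a x p q → s :* (a :* (p :+ x :* q)) := s :* (a :* p) :+ x :* (s :* (a :* q))) refl
    collect : ∀ a x b d p q → (a + x * b) * d + (p + x * q) ≈ (a * d + p) + x * (b * d + q)
    collect = solve 6 (λ a x b d p q → (a :+ x :* b) :* d :+ (p :+ x :* q) := (a :* d :+ p) :+ x :* (b :* d :+ q)) refl

  private
    -- `pinch k j` is where the inserted entry stands once the k-th of the other entries is gone.
    removeAt-insertAt : ∀ {n} (xs : Vector Carrier (suc n)) j v k →
      removeAt (Vector.insertAt xs j v) (punchIn j k) ≗ Vector.insertAt (removeAt xs k) (pinch k j) v
    removeAt-insertAt         xs zero    v k       zero    = ≡.refl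
    removeAt-insertAt         xs zero    v k       (suc l) = ≡.refl
    removeAt-insertAt         xs (suc j) v zero    l       = ≡.refl
    removeAt-insertAt {suc n} xs (suc j) v (suc k) zero    = ≡.refl
    removeAt-insertAt {suc n} xs (suc j) v (suc k) (suc l) = removeAt-insertAt (xs ∘ suc) j v k l

    -- If k < j, the exponents on the left are k and j - 1; otherwise they are k + 1 and j. Both
    -- sums have the parity of j + k + 1.
    sign-pinch : ∀ {n} (j : Fin (suc n)) (k : Fin n) →
      sign (toℕ (punchIn j k)) * sign (toℕ (pinch k j)) ≈ sign (toℕ j) * sign (suc (toℕ k))
    sign-pinch         zero    zero    = *-comm _ _
    sign-pinch         zero    (suc k) = *-comm _ _
    sign-pinch         (suc j) zero    = begin
      1# * sign (toℕ j)             ≈⟨ *-congˡ (sign-2+ (toℕ j)) ⟨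
      1# * (- 1# * sign (suc (toℕ j)))  ≈⟨ lemma _ _ ⟩
      sign (suc (toℕ j)) * sign 1   ∎
      where
      open Solver
      lemma : ∀ a b → 1# * (a * b) ≈ b * (a * 1#)
      lemma = solve 2 (λ a b → con 1 :* (a :* b) := b :* (a :* con 1)) refl
    sign-pinch {suc n} (suc j) (suc k) = begin
      (- 1# * p) * (- 1# * q)               ≈⟨ lemma _ _ _ ⟩
      - 1# * (- 1# * (p * q))               ≈⟨ *-congˡ (*-congˡ (sign-pinch j k)) ⟩
      - 1# * (- 1# * (sign (toℕ j) * sign (suc (toℕ k))))  ≈⟨ lemma′ _ _ _ ⟩
      sign (suc (toℕ j)) * sign (suc (suc (toℕ k)))  ∎
      where
      p = sign (toℕ (punchIn j k))
      q = sign (toℕ (pinch k j))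
      open Solver
      lemma : ∀ a b c → (a * b) * (a * c) ≈ a * (a * (b * c))
      lemma = solve 3 (λ a b c → (a :* b) :* (a :* c) := a :* (a :* (b :* c))) refl
      lemma′ : ∀ a b c → a * (a * (b * c)) ≈ (a * b) * (a * c)
      lemma′ = solve 3 (λ a b c → a :* (a :* (b :* c)) := (a :* b) :* (a :* c)) refl

  -- Both determinants are expanded along the first row. The inserted column contributes the same
  -- minor to each; in every other minor it survives at position `pinch k j`, and induction moves it
  -- to the front.
  det-insertAt : ∀ {n} (u : Vector Carrier (suc n)) C j →
    det (λ i → Vector.insertAt (C i) j (u i)) ≈ sign (toℕ j) * det (u ◂ C)
  det-insertAt {zero}  u C zero = trans (det-cong {M = λ i → Vector.insertAt (C i) zero (u i)} {u ◂ C} λ { i zero → refl ; i (suc ()) }) (sym (*-identityˡ _))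
  det-insertAt {suc n} u C j = begin
    det M
      ≈⟨ det-laplace M ⟩
    ∑ (λ p → sign (toℕ p) * (M zero p * det (minor M p)))
      ≈⟨ sum-remove {i = j} (λ p → sign (toℕ p) * (M zero p * det (minor M p))) ⟩
    sign (toℕ j) * (M zero j * det (minor M j)) +
    ∑ (λ k → sign (toℕ (punchIn j k)) * (M zero (punchIn j k) * det (minor M (punchIn j k))))
      ≈⟨ +-cong
           (*-congˡ (*-cong (reflexive (insertAt-lookup (C zero) j (u zero)))
                            (det-cong λ i l → reflexive (insertAt-punchIn (C (suc i)) j (u (suc i)) l))))
           (sum-cong-≋ λ k → begin
             sign (toℕ (punchIn j k)) * (M zero (punchIn j k) * det (minor M (punchIn j k)))
               ≈⟨ *-congˡ (*-cong (reflexive (insertAt-punchIn (C zero) j (u zero) k))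
                    (trans (det-cong λ i l → reflexive (removeAt-insertAt (C (suc i)) j (u (suc i)) k l))
                    (trans (det-insertAt (u ∘ suc) (λ i → removeAt (C (suc i)) k) (pinch k j))
                           (*-congˡ (sym (det-cong λ i l → reflexive (minor-◂ u C k i l))))))) ⟩
             sign (toℕ (punchIn j k)) * (C zero k * (sign (toℕ (pinch k j)) * det (minor (u ◂ C) (suc k))))
               ≈⟨ regroup _ _ _ _ ⟩
             (sign (toℕ (punchIn j k)) * sign (toℕ (pinch k j))) * (C zero k * det (minor (u ◂ C) (suc k)))
               ≈⟨ *-congʳ (sign-pinch j k) ⟩
             (sign (toℕ j) * sign (suc (toℕ k))) * (C zero k * det (minor (u ◂ C) (suc k)))
               ≈⟨ *-assoc _ _ _ ⟩
             sign (toℕ j) * (sign (suc (toℕ k)) * (C zero k * det (minor (u ◂ C) (suc k)))) ∎) ⟩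
    sign (toℕ j) * (u zero * det (C ∘ suc)) +
    ∑ (λ k → sign (toℕ j) * (sign (suc (toℕ k)) * (C zero k * det (minor (u ◂ C) (suc k)))))
      ≈⟨ +-congˡ (*-distribˡ-sum (sign (toℕ j)) (λ k → sign (suc (toℕ k)) * (C zero k * det (minor (u ◂ C) (suc k))))) ⟨
    sign (toℕ j) * (u zero * det (C ∘ suc)) +
    sign (toℕ j) * ∑ (λ k → sign (suc (toℕ k)) * (C zero k * det (minor (u ◂ C) (suc k))))
      ≈⟨ distribˡ _ _ _ ⟨
    sign (toℕ j) * (u zero * det (C ∘ suc) + ∑ (λ k → sign (suc (toℕ k)) * (C zero k * det (minor (u ◂ C) (suc k)))))
      ≈⟨ *-congˡ (det-◂ u C) ⟨
    sign (toℕ j) * det (u ◂ C) ∎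
    where
    M : Matrix (suc (suc n))
    M i = Vector.insertAt (C i) j (u i)
    open Solver
    regroup : ∀ s a t d → s * (a * (t * d)) ≈ (s * t) * (a * d)
    regroup = solve 4 (λ s a t d → s :* (a :* (t :* d)) := (s :* t) :* (a :* d)) refl

  -- This is I - M_σ diag(y). A separate variable for each column leaves room to multiply the
  -- variable of a deleted element into another column.
  characteristicMatrix : ∀ {n} → Vector Carrier n → Permutation′ n → Matrix n
  characteristicMatrix y σ i j = identityMatrix i j - y j * permutationMatrix σ i j

  characteristicDet : ∀ {n} → Vector Carrier n → Permutation′ n → Carrier
  characteristicDet y σ = det (characteristicMatrix y σ)

  characteristicDet-cong : ∀ {n} {y z : Vector Carrier n} (σ τ : Permutation′ n) →
    (∀ i → y i ≈ z i) → σ Perm.≈ τ → characteristicDet y σ ≈ characteristicDet z τ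
  characteristicDet-cong σ τ y≈z σ≈τ = det-cong λ i j → +-congˡ {identityMatrix i j}
   (-‿cong (*-cong (y≈z j) (reflexive (≡.cong (λ k → if does (i Fin.≟ k) then 1# else 0#) (σ≈τ j)))))

  private
    x-y*0≈x : ∀ x y → x - y * 0# ≈ x
    x-y*0≈x x y = trans (+-congˡ (trans (-‿cong (zeroʳ y)) -0#≈0#)) (+-identityʳ x)

    ∑-zero : ∀ {n} (f : Fin n → Carrier) → (∀ i → f i ≈ 0#) → ∑ f ≈ 0#
    ∑-zero {n} f f≈0 = trans (sum-cong-≋ f≈0) (sum-replicate-zero n)

  -- When 0 is fixed, the first row vanishes off the diagonal, so a single term of the row expansion
  -- survives.
  characteristicDet-fixed : ∀ {n} (y : Vector Carrier (suc n)) (π : Permutation′ n) →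
    characteristicDet y (insert zero zero π) ≈ (1# - y zero) * characteristicDet (y ∘ suc) π
  characteristicDet-fixed {n} y π = begin
    characteristicDet y (insert zero zero π)
      ≈⟨ det-laplace M ⟩
    1# * ((1# - y zero * 1#) * D) + ∑ rest
      ≈⟨ +-cong (trans (*-identityˡ _) (*-congʳ (+-congˡ (-‿cong (*-identityʳ _))))) (∑-zero rest rest≈0) ⟩
    (1# - y zero) * D + 0#
      ≈⟨ +-identityʳ _ ⟩
    (1# - y zero) * D ∎
    where
    M = characteristicMatrix y (insert zero zero π)
    D = characteristicDet (y ∘ suc) π
    rest : Fin n → Carrier
    rest k = sign (suc (toℕ k)) * ((0# - y (suc k) * 0#) * det (minor M (suc k)))
    rest≈0 : ∀ k → rest k ≈ 0#
    rest≈0 k = trans (*-congˡ (trans (*-congʳ (x-y*0≈x 0# _)) (zeroˡ _))) (zeroʳ _)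

  -- Both sides expand to det(v ◂ C) and det(u ◂ C), where C holds the columns
  -- of the right-hand matrix other than column j₀: the left side by its first
  -- row, which is zero outside columns 0 and j₀ + 1, the right side by linearity
  -- in column j₀, which is v + y(j₀ + 1) u.
  characteristicDet-contract : ∀ {n} (y : Vector Carrier (suc (suc n))) (y′ : Vector Carrier (suc n))
    (σ : Permutation′ (suc (suc n))) (π : Permutation′ (suc n)) (j₀ : Fin (suc n)) →
    σ ⟨$⟩ʳ zero ≡ suc (π ⟨$⟩ʳ j₀) → σ ⟨$⟩ʳ suc j₀ ≡ zero →
    (∀ k → σ ⟨$⟩ʳ suc (punchIn j₀ k) ≡ suc (π ⟨$⟩ʳ punchIn j₀ k)) →
    y′ j₀ ≈ y (suc j₀) * y zero → (∀ k → y′ (punchIn j₀ k) ≈ y (suc (punchIn j₀ k))) →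
    characteristicDet y σ ≈ characteristicDet y′ π
  characteristicDet-contract {n} y y′ σ π j₀ σ0 σj₀ σk y′j₀ y′k = begin
    det M
      ≈⟨ det-laplace M ⟩
    1# * (M zero zero * det (minor M zero)) + ∑ rest
      ≈⟨ +-cong (trans (*-identityˡ _) (trans (*-cong M00 minor0) (*-identityˡ _)))
                (trans (sum-remove {i = j₀} rest) (+-cong rest-j₀ (∑-zero _ rest-k))) ⟩
    det (λ i → Vector.insertAt (C i) j₀ (v i)) + (sign (suc (toℕ j₀)) * (- Y * det (u ◂ C)) + 0#)
      ≈⟨ +-cong (det-insertAt v C j₀) (trans (+-identityʳ _) resign) ⟩
    s * det (v ◂ C) + Y * (s * det (u ◂ C))
      ≈⟨ factor-out _ _ _ _ ⟩
    s * (det (v ◂ C) + Y * det (u ◂ C))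
      ≈⟨ *-congˡ (det-◂-linear Y v u C) ⟨
    s * det ((λ i → v i + Y * u i) ◂ C)
      ≈⟨ det-insertAt (λ i → v i + Y * u i) C j₀ ⟨
    det (λ i → Vector.insertAt (C i) j₀ (v i + Y * u i))
      ≈⟨ det-cong (λ i j → at-j₀ (N i) (C i) _ (column i) (λ k → refl) j) ⟨
    det N ∎
    where
    M = characteristicMatrix y σ
    N = characteristicMatrix y′ π
    s = sign (toℕ j₀)
    Y = y (suc j₀)
    C : Fin (suc n) → Vector Carrier n
    C i = removeAt (N i) j₀
    u v : Vector Carrier (suc n)
    u i = 0# - y zero * permutationMatrix π i j₀
    v i = identityMatrix i j₀
    rest : Fin (suc n) → Carrier
    rest k = sign (suc (toℕ k)) * (M zero (suc k) * det (minor M (suc k)))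

    unit : ∀ {n} → Fin n → Fin n → Carrier
    unit i k = if does (i Fin.≟ k) then 1# else 0#

    at-j₀ : (xs : Vector Carrier (suc n)) (ys : Vector Carrier n) (x : Carrier) →
      xs j₀ ≈ x → (∀ k → xs (punchIn j₀ k) ≈ ys k) → ∀ j → xs j ≈ Vector.insertAt ys j₀ x j
    at-j₀ xs ys x xs₀ xsₖ j with j₀ Fin.≟ j
    ... | yes ≡.refl = trans xs₀ (reflexive (≡.sym (insertAt-lookup ys j₀ x)))
    ... | no j₀≢j    = ≡.subst (λ j → xs j ≈ Vector.insertAt ys j₀ x j) (Fin.punchIn-punchOut j₀≢j)
          (trans (xsₖ _) (reflexive (≡.sym (insertAt-punchIn ys j₀ x _))))

    column : ∀ i → N i j₀ ≈ v i + Y * u i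
    column i = +-congˡ (begin
      - (y′ j₀ * p)             ≈⟨ -‿cong (*-congʳ y′j₀) ⟩
      - ((Y * y zero) * p)      ≈⟨ -‿cong (*-assoc _ _ _) ⟩
      - (Y * (y zero * p))      ≈⟨ -‿distribʳ-* Y _ ⟩
      Y * - (y zero * p)        ≈⟨ *-congˡ (+-identityˡ _) ⟨
      Y * u i                   ∎)
      where p = permutationMatrix π i j₀

    other-column : ∀ i k → M (suc i) (suc (punchIn j₀ k)) ≈ C i k
    other-column i k = +-congˡ (-‿cong (*-cong (sym (y′k k)) (reflexive (≡.cong (unit (suc i)) (σk k)))))

    M00 : M zero zero ≈ 1#
    M00 = trans (+-congˡ (-‿cong (*-congˡ (reflexive (≡.cong (unit zero) σ0))))) (x-y*0≈x 1# _)

    minor0 : det (minor M zero) ≈ det (λ i → Vector.insertAt (C i) j₀ (v i))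
    minor0 = det-cong λ i → at-j₀ (minor M zero i) (C i) (v i)
      (trans (+-congˡ (-‿cong (*-congˡ (reflexive (≡.cong (unit (suc i)) σj₀))))) (x-y*0≈x _ _))
      (other-column i)

    minor-j₀ : ∀ i j → minor M (suc j₀) i j ≈ (u ◂ C) i j
    minor-j₀ i zero    = +-congˡ (-‿cong (*-congˡ (reflexive (≡.cong (unit (suc i)) σ0))))
    minor-j₀ i (suc k) = other-column i k

    rest-j₀ : rest j₀ ≈ sign (suc (toℕ j₀)) * (- Y * det (u ◂ C))
    rest-j₀ = *-congˡ (*-cong
      (trans (+-identityˡ _) (-‿cong (trans (*-congˡ (reflexive (≡.cong (unit zero) σj₀))) (*-identityʳ _))))
      (det-cong minor-j₀))

    rest-k : ∀ k → rest (punchIn j₀ k) ≈ 0#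
    rest-k k = trans (*-congˡ (trans (*-congʳ (trans
      (+-congˡ (-‿cong (*-congˡ (reflexive (≡.cong (unit zero) (σk k)))))) (x-y*0≈x 0# _))) (zeroˡ _))) (zeroʳ _)

    open Solver
    resign : sign (suc (toℕ j₀)) * (- Y * det (u ◂ C)) ≈ Y * (s * det (u ◂ C))
    resign = trans (lemma _ _ _ _) (*-congʳ (trans (-1*x≈-x _) (-‿involutive _)))
      where
      lemma : ∀ a s b d → (a * s) * (b * d) ≈ (a * b) * (s * d)
      lemma = solve 4 (λ a s b d → (a :* s) :* (b :* d) := (a :* b) :* (s :* d)) refl
    factor-out : ∀ s p x q → s * p + x * (s * q) ≈ s * (p + x * q)
    factor-out = solve 4 (λ s p x q → s :* p :+ x :* (s :* q) := s :* (p :+ x :* q)) refl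

  -- For σ = insert zero (suc m) ρ, deleting 0 from its cycle leaves ρ followed by
  -- the cycle insert zero m id.
  bypass : ∀ {n} → Fin (suc n) → Permutation′ (suc n) → Permutation′ (suc n)
  bypass m ρ = ρ ∘ₚ insert zero m Perm.id

  -- `j₀` is the predecessor of 0: `ρ` sends it to 0, and `bypass m ρ` sends it to m, which is the
  -- image of 0 after renumbering. The conditions on y′ say that only its variable takes up that of
  -- 0.
  characteristicDet-bypass : ∀ {n} (y : Vector Carrier (suc (suc n))) (y′ : Vector Carrier (suc n)) m (ρ : Permutation′ (suc n)) →
    let j₀ = bypass m ρ ⟨$⟩ˡ m in
    y′ j₀ ≈ y (suc j₀) * y zero → (∀ k → y′ (punchIn j₀ k) ≈ y (suc (punchIn j₀ k))) →
    characteristicDet y (insert zero (suc m) ρ) ≈ characteristicDet y′ (bypass m ρ)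
  characteristicDet-bypass {n} y y′ m ρ =
    characteristicDet-contract y y′ (insert zero (suc m) ρ) π j₀
      (≡.cong suc (≡.sym πj₀)) (≡.cong (punchIn (suc m)) ρj₀) other
    where
    shift = insert zero m Perm.id
    π = bypass m ρ
    j₀ = π ⟨$⟩ˡ m
    πj₀ : π ⟨$⟩ʳ j₀ ≡ m
    πj₀ = Perm.inverseʳ π
    ρj₀ : ρ ⟨$⟩ʳ j₀ ≡ zero
    ρj₀ = ≡.trans (≡.sym (Perm.inverseˡ shift)) (≡.trans (≡.cong (shift ⟨$⟩ˡ_) πj₀) (Perm.inverseˡ shift {zero}))
    other : ∀ k → insert zero (suc m) ρ ⟨$⟩ʳ suc (punchIn j₀ k) ≡ suc (π ⟨$⟩ʳ punchIn j₀ k)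
    other k with ρ ⟨$⟩ʳ punchIn j₀ k in eq
    ... | suc q = ≡.refl
    -- By injectivity of `ρ`, only `j₀` is sent to 0.
    ... | zero  = ⊥-elim (Fin.punchInᵢ≢i j₀ k
          (≡.trans (≡.sym (Perm.inverseˡ ρ)) (≡.trans (≡.cong (ρ ⟨$⟩ˡ_) (≡.trans eq (≡.sym ρj₀))) (Perm.inverseˡ ρ))))

-- The recursion on weight vectors and its symmetry

-- An entry w of a weight vector stands for a cycle of length suc w, so merging
-- it with a cycle of weight a gives weight w + suc a.
absorb : ∀ {n} → Vec ℕ n → Fin n → ℕ → Vec ℕ n
absorb w i a = updateAt w i (ℕ._+ suc a)

absorb-comm : ∀ {n} (w : Vec ℕ n) i j a b → absorb (absorb w i a) j b ≡ absorb (absorb w j b) i a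
absorb-comm (x ∷ w) zero    zero    a b = ≡.cong (_∷ w)
  (≡.trans (ℕ.+-assoc x _ _) (≡.trans (≡.cong (x ℕ.+_) (ℕ.+-comm (suc a) (suc b))) (≡.sym (ℕ.+-assoc x _ _))))
absorb-comm (x ∷ w) zero    (suc j) a b = ≡.refl
absorb-comm (x ∷ w) (suc i) zero    a b = ≡.refl
absorb-comm (x ∷ w) (suc i) (suc j) a b = ≡.cong (x ∷_) (absorb-comm w i j a b)

absorb-insertAt : ∀ {n} (w : Vec ℕ n) i a b → absorb (insertAt w i a) i b ≡ insertAt w i (a ℕ.+ suc b)
absorb-insertAt w       zero    a b = ≡.refl
absorb-insertAt (x ∷ w) (suc i) a b = ≡.cong (x ∷_) (absorb-insertAt w i a b)

absorb-insertAt-punchIn : ∀ {n} (w : Vec ℕ n) i k a b →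
  absorb (insertAt w i a) (punchIn i k) b ≡ insertAt (absorb w k b) i a
absorb-insertAt-punchIn w       zero    k       a b = ≡.refl
absorb-insertAt-punchIn (x ∷ w) (suc i) zero    a b = ≡.refl
absorb-insertAt-punchIn (x ∷ w) (suc i) (suc k) a b = ≡.cong (x ∷_) (absorb-insertAt-punchIn w i k a b)

absorb-replicate : ∀ n i a → absorb (replicate (suc n) 0) i a ≡ insertAt (replicate n 0) i (suc a)
absorb-replicate n       zero    a = ≡.refl
absorb-replicate (suc n) (suc i) a = ≡.cong (0 ∷_) (absorb-replicate n i a)

module WeightRecursion {c ℓ} (A : CommutativeRing c ℓ) (h : ℕ → CommutativeRing.Carrier A) where
  open CommutativeRing A hiding (zero)
  open Matrices rawRing using (∑)
  open SemiringSum semiring using (sum-cong-≋; sum-remove; sum-replicate; ∑-comm; ∑-distrib-+; *-distribˡ-sum)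
  open SemiringMult semiring using (_×_; ×-comm-*; ×-assoc-*)
  private module Solver = SemiringSolver commutativeSemiring
  open SetoidReasoning setoid

  -- The recursion for S(w) read as a definition; it terminates because the vector gets shorter. It
  -- mentions neither permutations nor determinants.
  T : ∀ {n} → Vec ℕ n → Carrier
  T []      = 1#
  T (a ∷ w) = h a * T w + ∑ λ i → T (absorb w i a)

  -- After two expansions every ingredient is symmetric in a and b: merging both gives b + suc a = a
  -- + suc b, absorptions into w commute, and the two mixed terms h·∑ trade places.
  T-swap : ∀ {n} a b (w : Vec ℕ n) → T (a ∷ b ∷ w) ≈ T (b ∷ a ∷ w)
  T-swap a b w = begin
    T (a ∷ b ∷ w)
      ≈⟨ +-congˡ (+-congˡ (expand a b)) ⟩
    h a * (h b * T w + ∑ (λ i → T (absorb w i b))) +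
    (T (b ℕ.+ suc a ∷ w) + (h b * ∑ (λ i → T (absorb w i a)) + ∑∑ a b))
      ≈⟨ rearrange _ _ _ _ _ _ _ ⟩
    h b * (h a * T w + ∑ (λ i → T (absorb w i a))) +
    (T (b ℕ.+ suc a ∷ w) + (h a * ∑ (λ i → T (absorb w i b)) + ∑∑ a b))
      ≈⟨ +-congˡ (+-cong (reflexive (≡.cong (λ x → T (x ∷ w)) b+a)) (+-congˡ ∑∑-sym)) ⟩
    h b * (h a * T w + ∑ (λ i → T (absorb w i a))) +
    (T (a ℕ.+ suc b ∷ w) + (h a * ∑ (λ i → T (absorb w i b)) + ∑∑ b a))
      ≈⟨ +-congˡ (+-congˡ (expand b a)) ⟨
    T (b ∷ a ∷ w) ∎
    where
    ∑∑ : ℕ → ℕ → Carrier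
    ∑∑ a b = ∑ λ i → ∑ λ j → T (absorb (absorb w i a) j b)
    expand : ∀ a b → ∑ (λ i → T (b ∷ absorb w i a)) ≈ h b * ∑ (λ i → T (absorb w i a)) + ∑∑ a b
    expand a b = trans (∑-distrib-+ (λ i → h b * T (absorb w i a)) (λ i → ∑ λ j → T (absorb (absorb w i a) j b)))
      (+-congʳ (sym (*-distribˡ-sum (h b) (λ i → T (absorb w i a)))))
    b+a : b ℕ.+ suc a ≡ a ℕ.+ suc b
    b+a = ≡.trans (ℕ.+-suc b a) (≡.trans (≡.cong suc (ℕ.+-comm b a)) (≡.sym (ℕ.+-suc a b)))
    ∑∑-sym : ∑∑ a b ≈ ∑∑ b a
    ∑∑-sym = trans (∑-comm (λ i j → T (absorb (absorb w i a) j b)))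
      (sum-cong-≋ λ j → sum-cong-≋ λ i → reflexive (≡.cong T (absorb-comm w i j a b)))
    open Solver
    rearrange : ∀ x y t p q u s → x * (y * t + p) + (u + (y * q + s)) ≈ y * (x * t + q) + (u + (x * p + s))
    rearrange = solve 7 (λ x y t p q u s → x :* (y :* t :+ p) :+ (u :+ (y :* q :+ s))
                                        := y :* (x :* t :+ q) :+ (u :+ (x :* p :+ s))) refl

  -- On expanding at b, one summand lets position i absorb b while the others keep a there.
  -- Induction moves that entry to the front in each of them, which yields the expansion of
  -- `T (b ∷ a ∷ w)`; one swap remains.
  T-insertAt : ∀ {n} (w : Vec ℕ n) i a → T (insertAt w i a) ≈ T (a ∷ w)
  T-insertAt w               zero    a = refl
  T-insertAt (b ∷ w) (suc i) a = begin
    h b * T (insertAt w i a) + ∑ (λ j → T (absorb (insertAt w i a) j b))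
      ≈⟨ +-cong (*-congˡ (T-insertAt w i a)) (sum-remove {i = i} (λ j → T (absorb (insertAt w i a) j b))) ⟩
    h b * T (a ∷ w) + (T (absorb (insertAt w i a) i b) + ∑ (λ k → T (absorb (insertAt w i a) (punchIn i k) b)))
      ≈⟨ +-congˡ (+-cong
           (trans (reflexive (≡.cong T (absorb-insertAt w i a b))) (T-insertAt w i (a ℕ.+ suc b)))
           (sum-cong-≋ λ k → trans (reflexive (≡.cong T (absorb-insertAt-punchIn w i k a b))) (T-insertAt (absorb w k b) i a))) ⟩
    T (b ∷ a ∷ w)
      ≈⟨ T-swap b a w ⟩
    T (a ∷ b ∷ w) ∎

  T₀ : ℕ → Carrier
  T₀ n = T (replicate n 0)

  -- By symmetry it does not matter which of the equal entries absorbs a, so all absorption terms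
  -- coincide.
  T-∷-replicate : ∀ a n → T (a ∷ replicate (suc n) 0) ≈ h a * T₀ (suc n) + suc n × T (suc a ∷ replicate n 0)
  T-∷-replicate a n = +-congˡ (trans
    (sum-cong-≋ λ i → trans (reflexive (≡.cong T (absorb-replicate n i a))) (T-insertAt (replicate n 0) i (suc a)))
    (sum-replicate (suc n)))

  module _ (1/_! : ℕ → Carrier) (1/suc! : ∀ n → suc n × 1/ suc n ! ≈ 1/ n !) where

    -- The inverse factorial cancels the multiplicity `suc n` of the absorption term, so unrolling
    -- leaves a plain sum. The first entry is general because each unrolling raises it by one.
    T-∷-replicate/! : ∀ a n → 1/ n ! * T (a ∷ replicate n 0) ≈
      ∑ {suc n} λ j → h (a ℕ.+ toℕ j) * (1/ (n ∸ toℕ j) ! * T₀ (n ∸ toℕ j))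
    T-∷-replicate/! a zero = trans (lemma _ _) (+-congʳ (*-congʳ (reflexive (≡.cong h (≡.sym (ℕ.+-identityʳ a))))))
      where
      open Solver
      lemma : ∀ q x → q * (x * 1# + 0#) ≈ x * (q * 1#) + 0#
      lemma = solve 2 (λ q x → q :* (x :* con 1 :+ con 0) := x :* (q :* con 1) :+ con 0) refl
    T-∷-replicate/! a (suc n) = begin
      1/ suc n ! * T (a ∷ replicate (suc n) 0)
        ≈⟨ *-congˡ (T-∷-replicate a n) ⟩
      1/ suc n ! * (h a * T₀ (suc n) + suc n × T (suc a ∷ replicate n 0))
        ≈⟨ distribˡ _ _ _ ⟩
      1/ suc n ! * (h a * T₀ (suc n)) + 1/ suc n ! * (suc n × T (suc a ∷ replicate n 0))
        ≈⟨ +-cong (exchange _ _ _) (trans (×-comm-* (suc n) _ _) (sym (×-assoc-* (suc n) _ _))) ⟩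
      h a * (1/ suc n ! * T₀ (suc n)) + (suc n × 1/ suc n !) * T (suc a ∷ replicate n 0)
        ≈⟨ +-cong (*-congʳ (reflexive (≡.cong h (≡.sym (ℕ.+-identityʳ a)))))
                  (trans (*-congʳ (1/suc! n)) (T-∷-replicate/! (suc a) n)) ⟩
      h (a ℕ.+ 0) * (1/ suc n ! * T₀ (suc n)) +
      ∑ {suc n} (λ j → h (suc a ℕ.+ toℕ j) * (1/ (n ∸ toℕ j) ! * T₀ (n ∸ toℕ j)))
        ≈⟨ +-congˡ (sum-cong-≋ {suc n} λ j → *-congʳ {1/ (n ∸ toℕ j) ! * T₀ (n ∸ toℕ j)} (reflexive (≡.cong h (≡.sym (ℕ.+-suc a (toℕ j)))))) ⟩
      ∑ {suc (suc n)} (λ j → h (a ℕ.+ toℕ j) * (1/ (suc n ∸ toℕ j) ! * T₀ (suc n ∸ toℕ j))) ∎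
      where
      open Solver
      exchange : ∀ x y z → x * (y * z) ≈ y * (x * z)
      exchange = solve 3 (λ x y z → x :* (y :* z) := y :* (x :* z)) refl

-- Sums over permutations satisfy the weight recursion

module PermutationWeights {c ℓ} (A : CommutativeRing c ℓ) where
  open CommutativeRing A hiding (zero)
  open Determinants A using (bypass)
  open Matrices rawRing using (∑; ∑S)
  open SymmetricGroupSums A
  open SemiringSum semiring using (sum-cong-≋; sum-permute)
  open SetoidReasoning setoid

  module WeightSums (h : ℕ → Carrier) (G : ∀ {n} → Vec ℕ n → Permutation′ n → Carrier)
    (G-cong : ∀ {n} (w : Vec ℕ n) π ρ → π Perm.≈ ρ → G w π ≈ G w ρ)
    (G-[] : ∀ π → G [] π ≈ 1#)
    (G-fixed : ∀ {n} a (w : Vec ℕ n) π → G (a ∷ w) (insert zero zero π) ≈ h a * G w π)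
    (G-bypass : ∀ {n} a (w : Vec ℕ (suc n)) m ρ →
       G (a ∷ w) (insert zero (suc m) ρ) ≈ G (absorb w (bypass m ρ ⟨$⟩ˡ m) a) (bypass m ρ))
    where
    open WeightRecursion A h using (T)

    private
      -- The position that absorbs a depends on the permutation: it is π⁻¹(m) for π = `bypass m ρ`.
      -- For fixed m, π runs through the whole group along with ρ; for fixed π, π⁻¹(m) runs through
      -- all positions along with m. Exchanging the two sums thus removes the dependence.
      absorbing : ∀ {n} a (w : Vec ℕ n) →
        ∑ (λ m → ∑S n λ ρ → G (a ∷ w) (insert zero (suc m) ρ)) ≈ ∑ λ i → ∑S n (G (absorb w i a))
      absorbing {zero}  a w = refl
      absorbing {suc n} a w = begin
        ∑ (λ m → ∑S (suc n) λ ρ → G (a ∷ w) (insert zero (suc m) ρ))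
          ≈⟨ sum-cong-≋ (λ m → ∑S-cong (suc n) (G-bypass a w m)) ⟩
        ∑ (λ m → ∑S (suc n) λ ρ → F m (bypass m ρ))
          ≈⟨ sum-cong-≋ (λ m → ∑S-translate (suc n) (F m) (F-ext m) (insert zero m Perm.id)) ⟩
        ∑ (λ m → ∑S (suc n) (F m))
          ≈⟨ ∑S-∑ (suc n) F ⟨
        ∑S (suc n) (λ π → ∑ λ m → F m π)
          -- For each π separately, the substitution i = π⁻¹(m).
          ≈⟨ ∑S-cong (suc n) (λ π → sum-permute (λ i → G (absorb w i a) π) (Perm.flip π)) ⟨
        ∑S (suc n) (λ π → ∑ λ i → G (absorb w i a) π)
          ≈⟨ ∑S-∑ (suc n) (λ i → G (absorb w i a)) ⟩
        ∑ (λ i → ∑S (suc n) (G (absorb w i a))) ∎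
        where
        F : Fin (suc n) → Permutation′ (suc n) → Carrier
        F m π = G (absorb w (π ⟨$⟩ˡ m) a) π
        F-ext : ∀ m → Extensional (F m)
        F-ext m π ρ π≈ρ = trans (G-cong _ π ρ π≈ρ) (reflexive (≡.cong (λ i → G (absorb w i a) ρ) π⁻¹m≡ρ⁻¹m))
          where
          π⁻¹m≡ρ⁻¹m : π ⟨$⟩ˡ m ≡ ρ ⟨$⟩ˡ m
          π⁻¹m≡ρ⁻¹m = ≡.trans (≡.sym (Perm.inverseˡ ρ))
            (≡.cong (ρ ⟨$⟩ˡ_) (≡.trans (≡.sym (π≈ρ (π ⟨$⟩ˡ m))) (Perm.inverseʳ π)))

    ∑S-G≈T : ∀ {n} (w : Vec ℕ n) → ∑S n (G w) ≈ T w
    ∑S-G≈T []              = trans (+-identityʳ _) (G-[] _)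
    ∑S-G≈T {suc n} (a ∷ w) = begin
      ∑S (suc n) (G (a ∷ w))
        ≈⟨ ∑S-suc n (G (a ∷ w)) ⟩
      ∑S n (λ π → G (a ∷ w) (insert zero zero π)) + ∑ (λ m → ∑S n λ ρ → G (a ∷ w) (insert zero (suc m) ρ))
        ≈⟨ +-cong (trans (∑S-cong n (G-fixed a w)) (sym (∑S-*ˡ n (h a) (G w)))) (absorbing a w) ⟩
      h a * ∑S n (G w) + ∑ (λ i → ∑S n (G (absorb w i a)))
        ≈⟨ +-cong (*-congˡ (∑S-G≈T w)) (sum-cong-≋ λ i → ∑S-G≈T (absorb w i a)) ⟩
      T (a ∷ w) ∎

-- Products of powers of characteristic determinants

module CharacteristicDetAtZero {c ℓ} (A : CommutativeRing c ℓ) where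
  open CommutativeRing A hiding (zero)
  open Determinants A
  open RingProperties ring using (-0#≈0#)

  -- At y = 0 the matrix is the identity whatever σ is, so σ may be replaced by a permutation fixing
  -- 0 and the first element peeled off.
  characteristicDet-zero : ∀ {n} (y : Vector Carrier n) (σ : Permutation′ n) → (∀ i → y i ≈ 0#) → characteristicDet y σ ≈ 1#
  characteristicDet-zero {zero}  y σ y≈0 = trans (+-identityʳ _) (*-identityˡ 1#)
  characteristicDet-zero {suc n} y σ y≈0 = trans (det-cong λ i j → trans (entry σ i j) (sym (entry (insert zero zero Perm.id) i j)))
    (trans (characteristicDet-fixed y Perm.id) (trans
      (*-cong (trans (+-congˡ (trans (-‿cong (y≈0 zero)) -0#≈0#)) (+-identityʳ 1#)) (characteristicDet-zero (y ∘ suc) Perm.id (y≈0 ∘ suc)))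
      (*-identityˡ 1#)))
    where
    open Matrices rawRing using (identityMatrix)
    entry : ∀ (σ : Permutation′ (suc n)) i j → characteristicMatrix y σ i j ≈ identityMatrix i j
    entry σ i j = trans (+-congˡ (trans (-‿cong (trans (*-congʳ (y≈0 j)) (zeroˡ _))) -0#≈0#)) (+-identityʳ _)

module CycleSums {c ℓ} (A : CommutativeRing c ℓ) where
  open CommutativeRing A hiding (zero)
  open Determinants A using (characteristicDet; characteristicDet-cong; characteristicDet-fixed; characteristicDet-bypass; bypass)
  open SemiringExp semiring using (_^_; ^-homo-*)
  open SemiringMult semiring using (_×_)
  open Matrices rawRing using (∑; ∏; ∑S; det; identityMatrix; permutationMatrix)
  open SymmetricGroupSums A
  open SemiringSum semiring using (sum-cong-≋)
  private module ∏ = CommutativeMonoidSum *-commutativeMonoid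
  open SetoidReasoning setoid

  -- `Unipotent` will mean "has constant term 1", the domain on which a real power is
  -- multiplicative.
  module Powers {s : ℕ} (X : Fin s → Carrier) (power : Fin s → Carrier → Carrier) (Unipotent : Carrier → Set ℓ)
    (power-cong : ∀ i {f g} → f ≈ g → power i f ≈ power i g)
    (power-1 : ∀ i → power i 1# ≈ 1#)
    (power-* : ∀ i {f g} → Unipotent f → Unipotent g → power i (f * g) ≈ power i f * power i g)
    (1-X^-unipotent : ∀ i n → Unipotent (1# - X i ^ suc n))
    (det-unipotent : ∀ i {n} (w : Vec ℕ n) σ → Unipotent (characteristicDet (λ k → X i ^ suc (lookup w k)) σ))
    where

    h : ℕ → Carrier
    h n = ∏ λ i → power i (1# - X i ^ suc n)

    cycleSum : ℕ → Carrier
    cycleSum n = ∑S n λ σ → ∏ λ i → power i (det λ j k → identityMatrix j k - X i * permutationMatrix σ j k)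

    private
      y : ∀ {n} → Fin s → Vec ℕ n → Vector Carrier n
      y i w k = X i ^ suc (lookup w k)

    G : ∀ {n} → Vec ℕ n → Permutation′ n → Carrier
    G w σ = ∏ λ i → power i (characteristicDet (y i w) σ)

    G-cong : ∀ {n} (w : Vec ℕ n) π ρ → π Perm.≈ ρ → G w π ≈ G w ρ
    G-cong w π ρ π≈ρ = ∏.sum-cong-≋ λ i → power-cong i (characteristicDet-cong {y = y i w} π ρ (λ k → refl) π≈ρ)

    G-[] : ∀ π → G [] π ≈ 1#
    G-[] π = trans (∏.sum-cong-≋ λ i → trans
      (power-cong i (CharacteristicDetAtZero.characteristicDet-zero A (y i []) π λ ())) (power-1 i)) (∏.sum-replicate-zero s)

    G-fixed : ∀ {n} a (w : Vec ℕ n) π → G (a ∷ w) (insert zero zero π) ≈ h a * G w π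
    G-fixed a w π = trans
      (∏.sum-cong-≋ λ i → trans (power-cong i (characteristicDet-fixed (y i (a ∷ w)) π))
        (power-* i (1-X^-unipotent i a) (det-unipotent i w π)))
      (∏.∑-distrib-+ (λ i → power i (1# - X i ^ suc a)) (λ i → power i (characteristicDet (y i w) π)))

    G-bypass : ∀ {n} a (w : Vec ℕ (suc n)) m ρ →
      G (a ∷ w) (insert zero (suc m) ρ) ≈ G (absorb w (bypass m ρ ⟨$⟩ˡ m) a) (bypass m ρ)
    G-bypass a w m ρ = ∏.sum-cong-≋ λ i → power-cong i (characteristicDet-bypass (y i (a ∷ w)) (y i (absorb w j₀ a)) m ρ
      -- The merged exponent `suc (w + suc a)` is `suc w + suc a` by computation, so absorbing
      -- multiplies the two variables.
      (trans (reflexive (≡.cong (λ n → X i ^ suc n) (lookup∘updateAt j₀ w))) (^-homo-* (X i) (suc (lookup w j₀)) (suc a)))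
      (λ k → reflexive (≡.cong (λ n → X i ^ suc n) (lookup∘updateAt′ _ _ (Fin.punchInᵢ≢i j₀ k) w))))
      where j₀ = bypass m ρ ⟨$⟩ˡ m

    open PermutationWeights.WeightSums A h G G-cong G-[] G-fixed G-bypass
    open WeightRecursion A h

    cycleSum≈T₀ : ∀ n → cycleSum n ≈ T₀ n
    cycleSum≈T₀ n = trans (∑S-cong n λ σ → ∏.sum-cong-≋ λ i → power-cong i
      (characteristicDet-cong σ σ (λ k → trans (sym (*-identityʳ (X i)))
        (reflexive (≡.cong (λ n → X i ^ suc n) (≡.sym (lookup-replicate k 0))))) (λ _ → ≡.refl)))
      (∑S-G≈T (replicate n 0))

    module _ (1/_! : ℕ → Carrier) (1/suc! : ∀ n → suc n × 1/ suc n ! ≈ 1/ n !) where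

      cycleSum-recursion : ∀ m → 1/ m ! * cycleSum (suc m) ≈
        ∑ {suc m} λ j → h (toℕ j) * (1/ (m ∸ toℕ j) ! * cycleSum (m ∸ toℕ j))
      cycleSum-recursion m = trans (*-congˡ (cycleSum≈T₀ (suc m))) (trans (T-∷-replicate/! 1/_! 1/suc! 0 m)
        (sum-cong-≋ {suc m} λ j → *-congˡ {h (toℕ j)} (*-congˡ {1/ (m ∸ toℕ j) !} (sym (cycleSum≈T₀ (m ∸ toℕ j))))))

-- The ring of formal power series

infixl 6 _⊕_ _⊖_
_⊕_ _⊖_ : ∀ {k} → Vec ℕ k → Vec ℕ k → Vec ℕ k
_⊕_ = zipWith ℕ._+_
_⊖_ = zipWith _∸_

⊖-zero : ∀ {k} (e : Vec ℕ k) → e ⊖ replicate k 0 ≡ e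
⊖-zero []      = ≡.refl
⊖-zero (n ∷ e) = ≡.cong (n ∷_) (⊖-zero e)

sum-⊕ : ∀ {k} (a b : Vec ℕ k) → Vec.sum (a ⊕ b) ≡ Vec.sum a ℕ.+ Vec.sum b
sum-⊕ []      []      = ≡.refl
sum-⊕ (m ∷ a) (n ∷ b) = ≡.trans (≡.cong (m ℕ.+ n ℕ.+_) (sum-⊕ a b)) (interchange m n (Vec.sum a) (Vec.sum b))
  where open CommutativeSemigroupProperties ℕ.+-commutativeSemigroup using (interchange)

module SeriesRing {c ℓ} (R : CommutativeRing c ℓ) (ι : ℚ → CommutativeRing.Carrier R) (s : ℕ) where
  open CommutativeRing R hiding (zero)
  private module S = PowerSeries rawRing ι s
  open S using (∑≤; monomial)
  open Matrices rawRing using (∑)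
  open SemiringSum semiring using (sum-cong-≋; sum-replicate-zero; ∑-distrib-+; *-distribˡ-sum)
  open SetoidReasoning setoid

  -- All that matters about a summation index a ≤ e is that a + (e - a) = e.
  ∑≤-cong-≤ : ∀ {k} (e : Vec ℕ k) {f g} → (∀ a → a ⊕ (e ⊖ a) ≡ e → f a ≈ g a) → ∑≤ e f ≈ ∑≤ e g
  ∑≤-cong-≤ []      f≈g = f≈g [] ≡.refl
  ∑≤-cong-≤ (n ∷ e) f≈g = sum-cong-≋ λ i → ∑≤-cong-≤ e λ a a≤e →
    f≈g (toℕ i ∷ a) (≡.cong₂ _∷_ (ℕ.m+[n∸m]≡n (ℕ.≤-pred (Fin.toℕ<n i))) a≤e)

  ∑≤-cong : ∀ {k} (e : Vec ℕ k) {f g} → (∀ a → f a ≈ g a) → ∑≤ e f ≈ ∑≤ e g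
  ∑≤-cong e f≈g = ∑≤-cong-≤ e λ a _ → f≈g a

  ∑≤-+ : ∀ {k} (e : Vec ℕ k) f g → ∑≤ e (λ a → f a + g a) ≈ ∑≤ e f + ∑≤ e g
  ∑≤-+ []      f g = refl
  ∑≤-+ (n ∷ e) f g = trans (sum-cong-≋ λ (i : Fin (suc n)) → ∑≤-+ e (f ∘ (toℕ i ∷_)) (g ∘ (toℕ i ∷_)))
    (∑-distrib-+ (λ (i : Fin (suc n)) → ∑≤ e (f ∘ (toℕ i ∷_))) (λ i → ∑≤ e (g ∘ (toℕ i ∷_))))

  ∑≤-0 : ∀ {k} (e : Vec ℕ k) → ∑≤ e (λ _ → 0#) ≈ 0#
  ∑≤-0 []      = refl
  ∑≤-0 (n ∷ e) = trans (sum-cong-≋ λ (i : Fin (suc n)) → ∑≤-0 e) (sum-replicate-zero (suc n))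

  ∑≤-*ˡ : ∀ {k} (e : Vec ℕ k) x f → x * ∑≤ e f ≈ ∑≤ e (λ a → x * f a)
  ∑≤-*ˡ []      x f = refl
  ∑≤-*ˡ (n ∷ e) x f = trans (*-distribˡ-sum x (λ (i : Fin (suc n)) → ∑≤ e (f ∘ (toℕ i ∷_))))
    (sum-cong-≋ λ (i : Fin (suc n)) → ∑≤-*ˡ e x (f ∘ (toℕ i ∷_)))

  ∑≤-*ʳ : ∀ {k} (e : Vec ℕ k) x f → ∑≤ e f * x ≈ ∑≤ e (λ a → f a * x)
  ∑≤-*ʳ e x f = trans (*-comm _ x) (trans (∑≤-*ˡ e x f) (∑≤-cong e λ a → *-comm x (f a)))

  ∑≤-∑ : ∀ {k n} (e : Vec ℕ k) (f : Fin n → Vec ℕ k → Carrier) → ∑≤ e (λ a → ∑ λ i → f i a) ≈ ∑ λ i → ∑≤ e (f i)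
  ∑≤-∑ {n = zero}  e f = ∑≤-0 e
  ∑≤-∑ {n = suc n} e f = trans (∑≤-+ e (f zero) (λ a → ∑ λ i → f (suc i) a)) (+-congˡ (∑≤-∑ e (f ∘ suc)))

  ∑≤-single : ∀ {k} (e : Vec ℕ k) f → (∀ a → a ≢ replicate k 0 → f a ≈ 0#) → ∑≤ e f ≈ f (replicate k 0)
  ∑≤-single []      f f≈0 = refl
  ∑≤-single (n ∷ e) f f≈0 = begin
    ∑≤ e (f ∘ (0 ∷_)) + ∑ (λ (i : Fin n) → ∑≤ e (f ∘ (suc (toℕ i) ∷_)))
      ≈⟨ +-cong (∑≤-single e (f ∘ (0 ∷_)) λ a a≢0 → f≈0 (0 ∷ a) λ { ≡.refl → a≢0 ≡.refl })
           (trans (sum-cong-≋ {n} λ i → trans (∑≤-cong e λ a → f≈0 (suc (toℕ i) ∷ a) λ ()) (∑≤-0 e)) (sum-replicate-zero n)) ⟩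
    f (replicate _ 0) + 0#
      ≈⟨ +-identityʳ _ ⟩
    f (replicate _ 0) ∎

  private
    -- The sum over i + j = n, which is one coordinate of a Cauchy product; the laws in s variables
    -- reduce to it coordinate by coordinate.
    convolution : ℕ → (ℕ → ℕ → Carrier) → Carrier
    convolution n F = ∑ {suc n} λ i → F (toℕ i) (n ∸ toℕ i)

    convolution-cong : ∀ n {F G} → (∀ i j → F i j ≈ G i j) → convolution n F ≈ convolution n G
    convolution-cong n F≈G = sum-cong-≋ {suc n} λ i → F≈G (toℕ i) (n ∸ toℕ i)

    convolution-last : ∀ n F → convolution (suc n) F ≈ convolution n (λ i j → F i (suc j)) + F (suc n) 0
    convolution-last zero    F = trans (+-congˡ (+-identityʳ _)) (+-congʳ (sym (+-identityʳ _)))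
    convolution-last (suc n) F = trans (+-congˡ (convolution-last n (F ∘ suc))) (sym (+-assoc _ _ _))

    convolution-comm : ∀ n F → convolution n F ≈ convolution n (λ i j → F j i)
    convolution-comm zero    F = refl
    convolution-comm (suc n) F = begin
      F 0 (suc n) + convolution n (F ∘ suc)                ≈⟨ +-comm _ _ ⟩
      convolution n (F ∘ suc) + F 0 (suc n)                ≈⟨ +-congʳ (convolution-comm n (F ∘ suc)) ⟩
      convolution n (λ i j → F (suc j) i) + F 0 (suc n)    ≈⟨ convolution-last n (λ i j → F j i) ⟨
      convolution (suc n) (λ i j → F j i)                  ∎

    -- Both sides sum F over the triples with total n. Split off the triples whose first index is 0
    -- and apply induction to the rest.
    convolution-assoc : ∀ n (F : ℕ → ℕ → ℕ → Carrier) →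
      convolution n (λ i k → convolution i (λ j l → F j l k)) ≈ convolution n (λ i k → convolution k (F i))
    convolution-assoc zero    F = refl
    convolution-assoc (suc n) F = begin
      (F 0 0 (suc n) + 0#) + convolution n (λ i k → F 0 (suc i) k + convolution i (λ j l → F (suc j) l k))
        ≈⟨ +-cong (+-identityʳ _) (∑-distrib-+ {suc n} (λ i → F 0 (suc (toℕ i)) (n ∸ toℕ i))
             (λ i → convolution (toℕ i) (λ j l → F (suc j) l (n ∸ toℕ i)))) ⟩
      F 0 0 (suc n) + (convolution n (F 0 ∘ suc) + convolution n (λ i k → convolution i (λ j l → F (suc j) l k)))
        ≈⟨ +-assoc _ _ _ ⟨
      convolution (suc n) (F 0) + convolution n (λ i k → convolution i (λ j l → F (suc j) l k))
        ≈⟨ +-congˡ (convolution-assoc n (F ∘ suc)) ⟩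
      convolution (suc n) (F 0) + convolution n (λ i k → convolution k (F (suc i))) ∎

  -- With F a function of both parts of the splitting, no simplification of e ⊖ (e ⊖ a) arises in
  -- the induction.
  ∑≤-comm : ∀ {k} (e : Vec ℕ k) (F : Vec ℕ k → Vec ℕ k → Carrier) →
    ∑≤ e (λ a → F a (e ⊖ a)) ≈ ∑≤ e (λ a → F (e ⊖ a) a)
  ∑≤-comm []      F = refl
  ∑≤-comm (n ∷ e) F = trans
    (convolution-cong n λ i j → ∑≤-comm e λ a b → F (i ∷ a) (j ∷ b))
    (convolution-comm n λ i j → ∑≤ e λ a → F (i ∷ e ⊖ a) (j ∷ a))

  ∑≤-assoc : ∀ {k} (e : Vec ℕ k) (F : Vec ℕ k → Vec ℕ k → Vec ℕ k → Carrier) →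
    ∑≤ e (λ a → ∑≤ a λ b → F b (a ⊖ b) (e ⊖ a)) ≈ ∑≤ e (λ a → ∑≤ (e ⊖ a) λ b → F a b (e ⊖ a ⊖ b))
  ∑≤-assoc []      F = refl
  ∑≤-assoc (n ∷ e) F = begin
    convolution n (λ i k → ∑≤ e λ a → ∑ {suc i} λ j → ∑≤ a λ b → F (toℕ j ∷ b) (i ∸ toℕ j ∷ a ⊖ b) (k ∷ e ⊖ a))
      -- Pulling the inner head-coordinate sum out of the tail sum separates the two: induction
      -- handles the tail, `convolution-assoc` the head.
      ≈⟨ convolution-cong n (λ i k → ∑≤-∑ {n = suc i} e λ j a → ∑≤ a λ b → F (toℕ j ∷ b) (i ∸ toℕ j ∷ a ⊖ b) (k ∷ e ⊖ a)) ⟩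
    convolution n (λ i k → convolution i λ j l → ∑≤ e λ a → ∑≤ a λ b → F (j ∷ b) (l ∷ a ⊖ b) (k ∷ e ⊖ a))
      ≈⟨ convolution-cong n (λ i k → convolution-cong i λ j l → ∑≤-assoc e λ a b c → F (j ∷ a) (l ∷ b) (k ∷ c)) ⟩
    convolution n (λ i k → convolution i λ j l → F′ j l k)
      ≈⟨ convolution-assoc n F′ ⟩
    convolution n (λ i k → convolution k (F′ i))
      ≈⟨ convolution-cong n (λ i k → ∑≤-∑ {n = suc k} e λ j a → ∑≤ (e ⊖ a) λ b → F (i ∷ a) (toℕ j ∷ b) (k ∸ toℕ j ∷ e ⊖ a ⊖ b)) ⟨
    convolution n (λ i k → ∑≤ e λ a → ∑ {suc k} λ j → ∑≤ (e ⊖ a) λ b → F (i ∷ a) (toℕ j ∷ b) (k ∸ toℕ j ∷ e ⊖ a ⊖ b)) ∎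
    where
    F′ : ℕ → ℕ → ℕ → Carrier
    F′ i j k = ∑≤ e λ a → ∑≤ (e ⊖ a) λ b → F (i ∷ a) (j ∷ b) (k ∷ e ⊖ a ⊖ b)

  monomial-≢ : ∀ {a e} → a ≢ e → monomial a e ≈ 0#
  monomial-≢ {a} {e} a≢e with ≡-dec ℕ._≟_ a e
  ... | yes a≡e = contradiction a≡e a≢e
  ... | no  _   = refl

  monomial-refl : ∀ a → monomial a a ≈ 1#
  monomial-refl a with ≡-dec ℕ._≟_ a a
  ... | yes _   = refl
  ... | no  a≢a = contradiction ≡.refl a≢a

  *ˢ-comm : ∀ f g → f S.* g S.≈ g S.* f
  *ˢ-comm f g e = trans (∑≤-comm e λ a b → f a * g b) (∑≤-cong e λ a → *-comm _ _)

  *ˢ-assoc : ∀ f g h → (f S.* g) S.* h S.≈ f S.* (g S.* h)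
  *ˢ-assoc f g h e = begin
    ∑≤ e (λ a → ∑≤ a (λ b → f b * g (a ⊖ b)) * h (e ⊖ a))
      ≈⟨ ∑≤-cong e (λ a → trans (∑≤-*ʳ a _ _) (∑≤-cong a λ b → *-assoc _ _ _)) ⟩
    ∑≤ e (λ a → ∑≤ a (λ b → f b * (g (a ⊖ b) * h (e ⊖ a))))
      ≈⟨ ∑≤-assoc e (λ a b c → f a * (g b * h c)) ⟩
    ∑≤ e (λ a → ∑≤ (e ⊖ a) (λ b → f a * (g b * h (e ⊖ a ⊖ b))))
      ≈⟨ ∑≤-cong e (λ a → ∑≤-*ˡ (e ⊖ a) _ _) ⟨
    ∑≤ e (λ a → f a * ∑≤ (e ⊖ a) (λ b → g b * h (e ⊖ a ⊖ b))) ∎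

  *ˢ-identityˡ : ∀ f → S.1# S.* f S.≈ f
  *ˢ-identityˡ f e = begin
    ∑≤ e (λ a → S.1# a * f (e ⊖ a))
      ≈⟨ ∑≤-single e _ (λ a a≢0 → trans (*-congʳ (monomial-≢ (a≢0 ∘ ≡.sym))) (zeroˡ _)) ⟩
    S.1# (replicate s 0) * f (e ⊖ replicate s 0)
      ≈⟨ *-cong (monomial-refl (replicate s 0)) (reflexive (≡.cong f (⊖-zero e))) ⟩
    1# * f e
      ≈⟨ *-identityˡ _ ⟩
    f e ∎

  *ˢ-distribˡ : ∀ f g h → f S.* (g S.+ h) S.≈ f S.* g S.+ f S.* h
  *ˢ-distribˡ f g h e = trans (∑≤-cong e λ a → distribˡ _ _ _) (∑≤-+ e _ _)

  seriesIsCommutativeRing : IsCommutativeRing S._≈_ S._+_ S._*_ S.-_ S.0# S.1#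
  seriesIsCommutativeRing = record
    { isRing = record
      { +-isAbelianGroup = record
        { isGroup = record
          { isMonoid = record
            { isSemigroup = record
              { isMagma = record
                { isEquivalence = record
                  { refl  = λ e → refl
                  ; sym   = λ f≈g e → sym (f≈g e)
                  ; trans = λ f≈g g≈h e → trans (f≈g e) (g≈h e)
                  }
                ; ∙-cong = λ f≈g h≈k e → +-cong (f≈g e) (h≈k e)
                }
              ; assoc = λ f g h e → +-assoc _ _ _
              }
            ; identity = (λ f e → +-identityˡ _) , (λ f e → +-identityʳ _)
            }
          ; inverse = (λ f e → -‿inverseˡ _) , (λ f e → -‿inverseʳ _)
          ; ⁻¹-cong = λ f≈g e → -‿cong (f≈g e)
          }
        ; comm = λ f g e → +-comm _ _
        }
      ; *-cong = λ f≈g h≈k e → ∑≤-cong e λ a → *-cong (f≈g a) (h≈k _)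
      ; *-assoc = *ˢ-assoc
      ; *-identity = *ˢ-identityˡ , λ f e → trans (*ˢ-comm f S.1# e) (*ˢ-identityˡ f e)
      ; distrib = *ˢ-distribˡ , λ f g h e → trans (*ˢ-comm (g S.+ h) f e)
          (trans (*ˢ-distribˡ f g h e) (+-cong (*ˢ-comm f g e) (*ˢ-comm f h e)))
      }
    ; *-comm = *ˢ-comm
    }

  seriesCommutativeRing : CommutativeRing c ℓ
  seriesCommutativeRing = record { isCommutativeRing = seriesIsCommutativeRing }

-- Binomial series as solutions of a differential equation modulo a degree

-- A ring with congruences "equal modulo terms of degree ≥ k" and a derivation E
-- that, like the Euler derivation, is injective on elements without constant term.
record FilteredDifferentialRing c ℓ : Set (lsuc (c ⊔ ℓ)) where
  infix 4 _~[_]_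
  field
    commutativeRing : CommutativeRing c ℓ
  open CommutativeRing commutativeRing
  field
    _~[_]_              : Carrier → ℕ → Carrier → Set ℓ
    ~-isCommutativeRing : ∀ k → IsCommutativeRing _~[ k ]_ _+_ _*_ -_ 0# 1#
    ≈⇒~                 : ∀ {f g} k → f ≈ g → f ~[ k ] g
    ~-weaken            : ∀ {f g j k} → j ℕ.≤ k → f ~[ k ] g → f ~[ j ] g
    ~-zero              : ∀ {f g} → f ~[ 0 ] g
    ~-shift             : ∀ {x f g} k → x ~[ 1 ] 0# → f ~[ k ] g → x * f ~[ suc k ] x * g
    E                   : Carrier → Carrier
    E-~                 : ∀ {f g} k → f ~[ k ] g → E f ~[ k ] E g
    E-cong              : ∀ {f g} → f ≈ g → E f ≈ E g
    E-~-zero            : ∀ f → E f ~[ 1 ] 0#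
    E-+                 : ∀ f g → E (f + g) ≈ E f + E g
    E-*                 : ∀ f g → E (f * g) ≈ E f * g + f * E g
    E-1                 : E 1# ≈ 0#
    E-injective         : ∀ k {f g} → f ~[ 1 ] g → E f ~[ k ] E g → f ~[ k ] g

module BinomialSeries {c ℓ} (F : FilteredDifferentialRing c ℓ) where
  open FilteredDifferentialRing F
  open CommutativeRing commutativeRing hiding (zero)
  open SemiringMult semiring using (_×_; ×-comm-*; ×-assoc-*; ×-congʳ)
  open SemiringExp semiring using (_^_)

  truncatedRing : ℕ → CommutativeRing c ℓ
  truncatedRing k = record { isCommutativeRing = ~-isCommutativeRing k }

  private
    module T k = CommutativeRing (truncatedRing k)
    module Solver = SemiringSolver commutativeSemiring

  ~-*-zero : ∀ {x f} k → x ~[ 1 ] 0# → f ~[ k ] 0# → x * f ~[ suc k ] 0#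
  ~-*-zero {x} k x~0 f~0 = T.trans (suc k) (~-shift k x~0 f~0) (≈⇒~ (suc k) (zeroʳ x))

  ^-~-zero : ∀ {u} n → u ~[ 1 ] 0# → u ^ n ~[ n ] 0#
  ^-~-zero zero    u~0 = ~-zero
  ^-~-zero (suc n) u~0 = ~-*-zero n u~0 (^-~-zero n u~0)

  E-^ : ∀ u n → E (u ^ suc n) ≈ suc n × (u ^ n * E u)
  E-^ u zero    = trans (E-* u 1#) (trans (+-congˡ (trans (*-congˡ E-1) (zeroʳ u))) (+-congʳ (*-comm _ _)))
  E-^ u (suc n) = begin
    E (u * u ^ suc n)
      ≈⟨ E-* u (u ^ suc n) ⟩
    E u * u ^ suc n + u * E (u ^ suc n)
      ≈⟨ +-cong (*-comm _ _) (trans (*-congˡ (E-^ u n)) (×-comm-* (suc n) u _)) ⟩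
    u ^ suc n * E u + suc n × (u * (u ^ n * E u))
      ≈⟨ +-congˡ (×-congʳ (suc n) (*-assoc u _ _)) ⟨
    suc (suc n) × (u ^ suc n * E u) ∎
    where
    open SetoidReasoning setoid

  -- The truncations of y = ∑ cₙ uⁿ satisfy (1 + u) E y = α y E u modulo high
  -- degree when (n + 1) cₙ₊₁ + n cₙ = α cₙ, as the binomial coefficients do.
  module Power (α : Carrier) (coeff : ℕ → Carrier) (E-coeff : ∀ n → E (coeff n) ≈ 0#) (coeff-0 : coeff 0 ≈ 1#)
    (coeff-suc : ∀ n → α * coeff n ≈ suc n × coeff (suc n) + n × coeff n) where

    E-coeff* : ∀ n f → E (coeff n * f) ≈ coeff n * E f
    E-coeff* n f = trans (E-* (coeff n) f) (trans (+-congʳ (trans (*-congʳ (E-coeff n)) (zeroˡ f))) (+-identityˡ _))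

    partialSum : ℕ → Carrier → Carrier
    partialSum zero    u = coeff 0 * u ^ 0
    partialSum (suc n) u = partialSum n u + coeff (suc n) * u ^ suc n

    partialSum-cong : ∀ n {u v} → u ≈ v → partialSum n u ≈ partialSum n v
    partialSum-cong zero    u≈v = refl
    partialSum-cong (suc n) u≈v = +-cong (partialSum-cong n u≈v) (*-congˡ (SemiringExp.^-congˡ semiring (suc n) u≈v))

    partialSum-0th : ∀ u → partialSum 0 u ≈ 1#
    partialSum-0th u = trans (*-identityʳ _) coeff-0

    partialSum-zero : ∀ n {u} → u ≈ 0# → partialSum n u ≈ 1#
    partialSum-zero zero    {u} u≈0 = partialSum-0th u
    partialSum-zero (suc n) u≈0 = trans (+-cong (partialSum-zero n u≈0)
      (trans (*-congˡ (trans (*-congʳ u≈0) (zeroˡ _))) (zeroʳ _))) (+-identityʳ 1#)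

    partialSum-suc-~ : ∀ n {u} → u ~[ 1 ] 0# → partialSum (suc n) u ~[ suc n ] partialSum n u
    partialSum-suc-~ n u~0 = T.trans k
      (T.+-congˡ k (T.trans k (T.*-congˡ k (^-~-zero k u~0)) (≈⇒~ k (zeroʳ _)))) (≈⇒~ k (+-identityʳ _))
      where k = suc n

    partialSum-~ : ∀ n d {u} → u ~[ 1 ] 0# → partialSum (d ℕ.+ n) u ~[ suc n ] partialSum n u
    partialSum-~ n zero    u~0 = T.refl (suc n)
    partialSum-~ n (suc d) u~0 = T.trans (suc n)
      (~-weaken (ℕ.s≤s (ℕ.m≤n+m n d)) (partialSum-suc-~ (d ℕ.+ n) u~0)) (partialSum-~ n d u~0)

    partialSum-~-1 : ∀ n {u} → u ~[ 1 ] 0# → partialSum n u ~[ 1 ] 1#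
    partialSum-~-1 n {u} u~0 = T.trans 1
      (≡.subst (λ m → partialSum m u ~[ 1 ] partialSum 0 u) (ℕ.+-identityʳ n) (partialSum-~ 0 n u~0))
      (≈⇒~ 1 (partialSum-0th u))

    -- An exact identity, suited to induction: by the coefficient recurrence all terms cancel except
    -- the boundary term of order n + 1 shown on the left.
    partialSum-equation : ∀ n u → (1# + u) * E (partialSum n u) + (suc n × coeff (suc n)) * (u ^ n * E u)
                                ≈ α * (partialSum n u * E u)
    partialSum-equation zero u = begin
      (1# + u) * E (coeff 0 * 1#) + (coeff 1 + 0#) * (1# * E u)
        ≈⟨ +-congʳ (trans (*-congˡ (trans (E-coeff* 0 1#) (trans (*-congˡ E-1) (zeroʳ _)))) (zeroʳ _)) ⟩
      0# + (coeff 1 + 0#) * (1# * E u)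
        ≈⟨ lemma _ _ ⟩
      (coeff 1 + 0#) * E u
        ≈⟨ *-congʳ recurrence ⟩
      (α * coeff 0) * E u
        ≈⟨ lemma′ _ _ _ ⟩
      α * ((coeff 0 * 1#) * E u) ∎
      where
      open SetoidReasoning setoid
      open Solver
      lemma : ∀ a d → 0# + (a + 0#) * (1# * d) ≈ (a + 0#) * d
      lemma = solve 2 (λ a d → con 0 :+ (a :+ con 0) :* (con 1 :* d) := (a :+ con 0) :* d) refl
      lemma′ : ∀ a c d → (a * c) * d ≈ a * ((c * 1#) * d)
      lemma′ = solve 3 (λ a c d → (a :* c) :* d := a :* ((c :* con 1) :* d)) refl
      recurrence : coeff 1 + 0# ≈ α * coeff 0
      recurrence = sym (trans (coeff-suc 0) (+-identityʳ _))
    partialSum-equation (suc n) u = begin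
      (1# + u) * E (p + c′ * (u * U)) + δ′ * ((u * U) * D)
        ≈⟨ +-congʳ (*-congˡ (begin
             E (p + c′ * (u * U))               ≈⟨ E-+ p _ ⟩
             E p + E (c′ * (u * U))             ≈⟨ +-congˡ (E-coeff* (suc n) (u * U)) ⟩
             E p + c′ * E (u * U)               ≈⟨ +-congˡ (*-congˡ (E-^ u n)) ⟩
             E p + c′ * (suc n × (U * D))       ≈⟨ +-congˡ (trans (×-comm-* (suc n) c′ _) (sym (×-assoc-* (suc n) c′ _))) ⟩
             E p + δ * (U * D)                  ∎)) ⟩
      (1# + u) * (E p + δ * (U * D)) + δ′ * ((u * U) * D)
        ≈⟨ expand _ _ _ _ _ _ ⟩
      ((1# + u) * E p + δ * (U * D)) + (δ′ + δ) * ((u * U) * D)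
        ≈⟨ +-cong (partialSum-equation n u) (*-congʳ recurrence) ⟩
      α * (p * D) + (α * c′) * ((u * U) * D)
        ≈⟨ collect _ _ _ _ _ ⟩
      α * ((p + c′ * (u * U)) * D) ∎
      where
      open SetoidReasoning setoid
      p c′ δ δ′ U D : Carrier
      p  = partialSum n u
      c′ = coeff (suc n)
      δ  = suc n × coeff (suc n)
      δ′ = suc (suc n) × coeff (suc (suc n))
      U  = u ^ n
      D  = E u
      recurrence : δ′ + δ ≈ α * c′
      recurrence = sym (coeff-suc (suc n))
      open Solver
      expand : ∀ u p δ U D δ′ → (1# + u) * (p + δ * (U * D)) + δ′ * ((u * U) * D)
                              ≈ ((1# + u) * p + δ * (U * D)) + (δ′ + δ) * ((u * U) * D)
      expand = solve 6 (λ u p δ U D δ′ → (con 1 :+ u) :* (p :+ δ :* (U :* D)) :+ δ′ :* ((u :* U) :* D)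
        := ((con 1 :+ u) :* p :+ δ :* (U :* D)) :+ (δ′ :+ δ) :* ((u :* U) :* D)) refl
      collect : ∀ a p D c W → a * (p * D) + (a * c) * (W * D) ≈ a * ((p + c * W) * D)
      collect = solve 5 (λ a p D c W → a :* (p :* D) :+ (a :* c) :* (W :* D) := a :* ((p :+ c :* W) :* D)) refl

    -- The equation E y / y = α E f / f of logarithmic derivatives, cleared of denominators.
    Solves : ℕ → Carrier → Carrier → Set _
    Solves k f y = f * E y ~[ k ] α * (y * E f)

    E[1+u] : ∀ u → E (1# + u) ≈ E u
    E[1+u] u = trans (E-+ 1# u) (trans (+-congʳ E-1) (+-identityˡ _))

    partialSum-solves : ∀ n {u} → u ~[ 1 ] 0# → Solves (suc n) (1# + u) (partialSum n u)
    partialSum-solves n {u} u~0 = begin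
      (1# + u) * E p
        ≈⟨ ≈⇒~ k (+-identityʳ _) ⟨
      (1# + u) * E p + 0#
        ≈⟨ T.+-congˡ k (T.trans k (T.*-congˡ k (T.trans k (≈⇒~ k (*-comm _ _)) (~-*-zero n (E-~-zero u) (^-~-zero n u~0)))) (≈⇒~ k (zeroʳ _))) ⟨
      (1# + u) * E p + (suc n × coeff (suc n)) * (u ^ n * E u)
        ≈⟨ ≈⇒~ k (partialSum-equation n u) ⟩
      α * (p * E u)
        ≈⟨ ≈⇒~ k (*-congˡ (*-congˡ (E[1+u] u))) ⟨
      α * (p * E (1# + u)) ∎
      where
      k = suc n
      p = partialSum n u
      open SetoidReasoning (T.setoid k)

    -- Logarithmic derivatives of products add.
    solves-* : ∀ k f g y z → Solves k f y → Solves k g z → Solves k (f * g) (y * z)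
    solves-* k f g y z fy gz = begin
      (f * g) * E (y * z)
        ≈⟨ ≈⇒~ k (trans (*-congˡ (E-* y z)) (expand _ _ _ _ _ _)) ⟩
      (g * z) * (f * E y) + (f * y) * (g * E z)
        ≈⟨ T.+-cong k (T.*-congˡ k fy) (T.*-congˡ k gz) ⟩
      (g * z) * (α * (y * E f)) + (f * y) * (α * (z * E g))
        ≈⟨ ≈⇒~ k (trans (collect _ _ _ _ _ _ _) (*-congˡ (*-congˡ (sym (E-* f g))))) ⟩
      α * ((y * z) * E (f * g)) ∎
      where
      open SetoidReasoning (T.setoid k)
      open Solver
      expand : ∀ f g y z y′ z′ → (f * g) * (y′ * z + y * z′) ≈ (g * z) * (f * y′) + (f * y) * (g * z′)
      expand = solve 6 (λ f g y z y′ z′ → (f :* g) :* (y′ :* z :+ y :* z′) := (g :* z) :* (f :* y′) :+ (f :* y) :* (g :* z′)) refl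
      collect : ∀ a f g y z f′ g′ → (g * z) * (a * (y * f′)) + (f * y) * (a * (z * g′)) ≈ a * ((y * z) * (f′ * g + f * g′))
      collect = solve 7 (λ a f g y z f′ g′ → (g :* z) :* (a :* (y :* f′)) :+ (f :* y) :* (a :* (z :* g′))
        := a :* ((y :* z) :* (f′ :* g :+ f :* g′))) refl

    solves-cong : ∀ k {f g} y → f ≈ g → Solves k f y → Solves k g y
    solves-cong k y f≈g fy = T.trans k (≈⇒~ k (*-congʳ (sym f≈g))) (T.trans k fy (≈⇒~ k (*-congˡ (*-congˡ (E-cong f≈g)))))

    -- Induction on the degree k: modulo degree k + 1, the terms u E y and
    -- y E u only see y modulo degree k.
    solves-unique : ∀ K {u y z} → u ~[ 1 ] 0# → y ~[ 1 ] z → Solves K (1# + u) y → Solves K (1# + u) z →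
      ∀ k → k ℕ.≤ K → y ~[ k ] z
    solves-unique K u~0 y~z uy uz zero          k≤K = ~-zero
    solves-unique K {u} {y} {z} u~0 y~z uy uz (suc k) k<K = E-injective (suc k) y~z
      (RingProperties.+-cancelʳ (T.ring (suc k)) (u * E z) (E y) (E z) (begin
        E y + u * E z             ≈⟨ T.+-congˡ (suc k) (~-shift k u~0 (E-~ k IH)) ⟨
        E y + u * E y             ≈⟨ ≈⇒~ (suc k) (expand _ _) ⟨
        (1# + u) * E y            ≈⟨ ~-weaken k<K uy ⟩
        α * (y * E (1# + u))    ≈⟨ T.*-congˡ (suc k) (≈⇒~ (suc k) (*-comm _ _)) ⟩
        α * (E (1# + u) * y)    ≈⟨ T.*-congˡ (suc k) (~-shift k (E-~-zero (1# + u)) IH) ⟩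
        α * (E (1# + u) * z)    ≈⟨ T.*-congˡ (suc k) (≈⇒~ (suc k) (*-comm _ _)) ⟩
        α * (z * E (1# + u))    ≈⟨ ~-weaken k<K uz ⟨
        (1# + u) * E z            ≈⟨ ≈⇒~ (suc k) (expand _ _) ⟩
        E z + u * E z             ∎))
      where
      open SetoidReasoning (T.setoid (suc k))
      IH : y ~[ k ] z
      IH = solves-unique K u~0 y~z uy uz k (ℕ.≤-trans (ℕ.n≤1+n k) k<K)
      expand : ∀ u x → (1# + u) * x ≈ x + u * x
      expand u x = trans (distribʳ x 1# u) (+-congʳ (*-identityˡ x))

    -- Both sides have constant term 1 and solve the equation for 1 + w, the right one by the
    -- product rule; `solves-unique` identifies them.
    partialSum-* : ∀ n {u v w} → u ~[ 1 ] 0# → v ~[ 1 ] 0# → w ~[ 1 ] 0# → (1# + u) * (1# + v) ≈ 1# + w →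
      partialSum n w ~[ suc n ] partialSum n u * partialSum n v
    partialSum-* n {u} {v} {w} u~0 v~0 w~0 uv≈w = solves-unique (suc n) w~0
      (T.trans 1 (partialSum-~-1 n w~0) (T.sym 1 (T.trans 1
        (T.*-cong 1 (partialSum-~-1 n u~0) (partialSum-~-1 n v~0)) (≈⇒~ 1 (*-identityˡ 1#)))))
      (partialSum-solves n w~0)
      (solves-cong (suc n) (partialSum n u * partialSum n v) uv≈w
        (solves-* (suc n) (1# + u) (1# + v) (partialSum n u) (partialSum n v) (partialSum-solves n u~0) (partialSum-solves n v~0)))
      (suc n) ℕ.≤-refl

sum-replicate-0 : ∀ k → Vec.sum (replicate k 0) ≡ 0
sum-replicate-0 zero    = ≡.refl
sum-replicate-0 (suc k) = sum-replicate-0 k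

-- Truncation by total degree and the Euler derivation on series

module Truncation {c ℓ} (R : CommutativeRing c ℓ) (ι : ℚ → CommutativeRing.Carrier R) (s : ℕ) where
  private module R = CommutativeRing R
  open SeriesRing R ι s
  open CommutativeRing seriesCommutativeRing hiding (zero)
  open PowerSeries R.rawRing ι s using (Series; ∑≤; _·_)
  open SemiringMult R.semiring using (×-congˡ; ×-congʳ; ×-homo-+; ×-comm-*; ×-assoc-*) renaming (_×_ to _×ᴿ_)
  open SemiringMult semiring using (_×_)

  private
    degree-⊕ : ∀ {e a : Vec ℕ s} → a ⊕ (e ⊖ a) ≡ e → Vec.sum e ≡ Vec.sum a ℕ.+ Vec.sum (e ⊖ a)
    degree-⊕ {e} {a} a≤e = ≡.trans (≡.cong Vec.sum (≡.sym a≤e)) (sum-⊕ a (e ⊖ a))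

  infix 4 _~[_]_
  record _~[_]_ (f : Series) (k : ℕ) (g : Series) : Set ℓ where
    constructor truncated
    field at : ∀ e → Vec.sum e ℕ.< k → f e R.≈ g e
  open _~[_]_ public

  ≈⇒~ : ∀ {f g} k → f ≈ g → f ~[ k ] g
  ≈⇒~ k f≈g = truncated λ e _ → f≈g e

  ~⇒≈ : ∀ {f g} → (∀ k → f ~[ suc k ] g) → f ≈ g
  ~⇒≈ f~g e = at (f~g (Vec.sum e)) e ℕ.≤-refl

  ~-weaken : ∀ {f g j k} → j ℕ.≤ k → f ~[ k ] g → f ~[ j ] g
  ~-weaken j≤k f~g = truncated λ e e<j → at f~g e (ℕ.≤-trans e<j j≤k)

  ~-zero : ∀ {f g} → f ~[ 0 ] g
  ~-zero = truncated λ e ()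

  ~-isCommutativeRing : ∀ k → IsCommutativeRing _~[ k ]_ _+_ _*_ -_ 0# 1#
  ~-isCommutativeRing k = record
    { isRing = record
      { +-isAbelianGroup = record
        { isGroup = record
          { isMonoid = record
            { isSemigroup = record
              { isMagma = record
                { isEquivalence = record
                  { refl  = truncated λ e _ → R.refl
                  ; sym   = λ f~g → truncated λ e e<k → R.sym (at f~g e e<k)
                  ; trans = λ f~g g~h → truncated λ e e<k → R.trans (at f~g e e<k) (at g~h e e<k)
                  }
                ; ∙-cong = λ f~g h~i → truncated λ e e<k → R.+-cong (at f~g e e<k) (at h~i e e<k)
                }
              ; assoc = λ f g h → ≈⇒~ k (+-assoc f g h)
              }
            ; identity = (λ f → ≈⇒~ {0# + f} k (+-identityˡ f)) , (λ f → ≈⇒~ k (+-identityʳ f))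
            }
          ; inverse = (λ f → ≈⇒~ k (-‿inverseˡ f)) , (λ f → ≈⇒~ k (-‿inverseʳ f))
          ; ⁻¹-cong = λ f~g → truncated λ e e<k → R.-‿cong (at f~g e e<k)
          }
        ; comm = λ f g → ≈⇒~ k (+-comm f g)
        }
      ; *-cong = λ f~g h~i → truncated λ e e<k → ∑≤-cong-≤ e λ a a≤e → R.*-cong
          (at f~g a (ℕ.≤-trans (ℕ.s≤s (ℕ.≤-trans (ℕ.m≤m+n _ _) (ℕ.≤-reflexive (≡.sym (degree-⊕ {e} {a} a≤e))))) e<k))
          (at h~i (e ⊖ a) (ℕ.≤-trans (ℕ.s≤s (ℕ.≤-trans (ℕ.m≤n+m _ (Vec.sum a)) (ℕ.≤-reflexive (≡.sym (degree-⊕ {e} {a} a≤e))))) e<k))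
      ; *-assoc = λ f g h → ≈⇒~ k (*-assoc f g h)
      ; *-identity = (λ f → ≈⇒~ k (*-identityˡ f)) , (λ f → ≈⇒~ k (*-identityʳ f))
      ; distrib = (λ f g h → ≈⇒~ k (distribˡ f g h)) , (λ f g h → ≈⇒~ k (distribʳ f g h))
      }
    ; *-comm = λ f g → ≈⇒~ k (*-comm f g)
    }

  -- In the product, a term with a of degree 0 vanishes because `x` has no constant term; in every
  -- other term the second factor is evaluated below degree k.
  ~-shift : ∀ {x f g} k → x ~[ 1 ] 0# → f ~[ k ] g → x * f ~[ suc k ] x * g
  ~-shift {x} {f} {g} k x~0 f~g = truncated λ e e≤k → ∑≤-cong-≤ e λ a a≤e → helper e e≤k a a≤e
    where
    helper : ∀ e → Vec.sum e ℕ.< suc k → ∀ a → a ⊕ (e ⊖ a) ≡ e → x a R.* f (e ⊖ a) R.≈ x a R.* g (e ⊖ a)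
    helper e e≤k a a≤e with Vec.sum a in eq
    ... | zero  = R.trans (R.*-congʳ xa≈0) (R.trans (R.zeroˡ _) (R.sym (R.trans (R.*-congʳ xa≈0) (R.zeroˡ _))))
      where
      xa≈0 : x a R.≈ R.0#
      xa≈0 = at x~0 a (ℕ.s≤s (ℕ.≤-reflexive eq))
    ... | suc m = R.*-congˡ (at f~g (e ⊖ a) (ℕ.≤-pred (ℕ.≤-trans
          (ℕ.s≤s (ℕ.s≤s (ℕ.m≤n+m _ m)))
          (ℕ.≤-trans (ℕ.≤-reflexive (≡.cong suc (≡.sym (≡.trans (degree-⊕ {e} {a} a≤e) (≡.cong (ℕ._+ Vec.sum (e ⊖ a)) eq))))) e≤k))))

  -- Constant series turn scalars into ring elements, so that identities proved over arbitrary
  -- commutative rings can carry binomial coefficients and inverse factorials.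
  C : R.Carrier → Series
  C x = x · 1#

  C-* : ∀ x f → C x * f ≈ x · f
  C-* x f e = R.trans (R.trans (∑≤-cong e λ a → R.*-assoc x (1# a) (f (e ⊖ a))) (R.sym (∑≤-*ˡ e x λ a → 1# a R.* f (e ⊖ a)))) (R.*-congˡ (*-identityˡ f e))

  C-cong : ∀ {x y} → x R.≈ y → C x ≈ C y
  C-cong x≈y e = R.*-congʳ x≈y

  C-+ : ∀ x y → C (x R.+ y) ≈ C x + C y
  C-+ x y e = R.distribʳ _ x y

  C-mul : ∀ x y → C (x R.* y) ≈ C x * C y
  C-mul x y e = R.trans (R.*-assoc x y _) (R.sym (C-* x (C y) e))

  C-1 : C R.1# ≈ 1#
  C-1 e = R.*-identityˡ _

  ×-coefficient : ∀ n f e → (n × f) e R.≈ n ×ᴿ f e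
  ×-coefficient zero    f e = R.refl
  ×-coefficient (suc n) f e = R.+-congˡ (×-coefficient n f e)

  C-× : ∀ n x → C (n ×ᴿ x) ≈ n × C x
  C-× n x e = R.trans (×-assoc-* n x _) (R.sym (×-coefficient n (C x) e))

  -- The Euler derivation ∑ xᵢ ∂/∂xᵢ.
  E : Series → Series
  E f e = Vec.sum e ×ᴿ f e

  E-cong : ∀ {f g} → f ≈ g → E f ≈ E g
  E-cong f≈g e = ×-congʳ (Vec.sum e) (f≈g e)

  E-~ : ∀ {f g} k → f ~[ k ] g → E f ~[ k ] E g
  E-~ k f~g = truncated λ e e<k → ×-congʳ (Vec.sum e) (at f~g e e<k)

  E-~-zero : ∀ f → E f ~[ 1 ] 0#
  E-~-zero f = truncated λ { e (ℕ.s≤s e≤0) → ×-congˡ {f e} (ℕ.n≤0⇒n≡0 e≤0) }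

  E-+ : ∀ f g → E (f + g) ≈ E f + E g
  E-+ f g e = ×-distrib-+ (Vec.sum e)
    where
    open SemiringSolver R.commutativeSemiring
    interchange : ∀ a b c d → (a R.+ b) R.+ (c R.+ d) R.≈ (a R.+ c) R.+ (b R.+ d)
    interchange = solve 4 (λ a b c d → (a :+ b) :+ (c :+ d) := (a :+ c) :+ (b :+ d)) R.refl
    ×-distrib-+ : ∀ n → n ×ᴿ (f e R.+ g e) R.≈ n ×ᴿ f e R.+ n ×ᴿ g e
    ×-distrib-+ zero    = R.sym (R.+-identityˡ _)
    ×-distrib-+ (suc n) = R.trans (R.+-congˡ (×-distrib-+ n)) (interchange _ _ _ _)

  -- In each term of the product, the degree of e is the sum of the degrees of a and e ⊖ a.
  E-* : ∀ f g → E (f * g) ≈ E f * g + f * E g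
  E-* f g e = begin
    n ×ᴿ ∑≤ e (λ a → f a R.* g (e ⊖ a))
      -- The multiple is rewritten as multiplication by n × 1, which distributes over `∑≤`.
      ≈⟨ 1×-* n _ ⟨
    n ×ᴿ R.1# R.* ∑≤ e (λ a → f a R.* g (e ⊖ a))
      ≈⟨ ∑≤-*ˡ e _ _ ⟩
    ∑≤ e (λ a → n ×ᴿ R.1# R.* (f a R.* g (e ⊖ a)))
      ≈⟨ ∑≤-cong-≤ e (λ a a≤e → begin
           n ×ᴿ R.1# R.* (f a R.* g (e ⊖ a))
             ≈⟨ 1×-* n _ ⟩
           n ×ᴿ (f a R.* g (e ⊖ a))
             ≈⟨ ×-congˡ (degree-⊕ {e} {a} a≤e) ⟩
           (Vec.sum a ℕ.+ Vec.sum (e ⊖ a)) ×ᴿ (f a R.* g (e ⊖ a))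
             ≈⟨ ×-homo-+ _ (Vec.sum a) (Vec.sum (e ⊖ a)) ⟩
           Vec.sum a ×ᴿ (f a R.* g (e ⊖ a)) R.+ Vec.sum (e ⊖ a) ×ᴿ (f a R.* g (e ⊖ a))
             ≈⟨ R.+-cong (×-assoc-* (Vec.sum a) _ _) (×-comm-* (Vec.sum (e ⊖ a)) _ _) ⟨
           E f a R.* g (e ⊖ a) R.+ f a R.* E g (e ⊖ a) ∎) ⟩
    ∑≤ e (λ a → E f a R.* g (e ⊖ a) R.+ f a R.* E g (e ⊖ a))
      ≈⟨ ∑≤-+ e _ _ ⟩
    (E f * g + f * E g) e ∎
    where
    n = Vec.sum e
    open SetoidReasoning R.setoid
    1×-* : ∀ n x → n ×ᴿ R.1# R.* x R.≈ n ×ᴿ x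
    1×-* n x = R.trans (×-assoc-* n R.1# x) (×-congʳ n (R.*-identityˡ x))

  E-C : ∀ x → E (C x) ≈ 0#
  E-C x e with Vec.sum e in eq
  ... | zero  = R.refl
  ... | suc n = R.trans (×-congʳ (suc n) (R.trans (R.*-congˡ (monomial-≢ 0≢e)) (R.zeroʳ x))) (×-0 (suc n))
    where
    0≢e : replicate s 0 ≢ e
    0≢e ≡.refl with ≡.trans (≡.sym (sum-replicate-0 s)) eq
    ... | ()
    ×-0 : ∀ n → n ×ᴿ R.0# R.≈ R.0#
    ×-0 zero    = R.refl
    ×-0 (suc n) = R.trans (R.+-identityˡ _) (×-0 n)

  E-1 : E 1# ≈ 0#
  E-1 = trans (E-cong (sym C-1)) (E-C R.1#)

  module _ (inverse : ℕ → R.Carrier) (inverse-suc : ∀ n → suc n ×ᴿ inverse n R.≈ R.1#) where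

    -- `E` multiplies a coefficient of degree n + 1 by n + 1, which is invertible; in degree 0 the
    -- first hypothesis decides.
    E-injective : ∀ k {f g} → f ~[ 1 ] g → E f ~[ k ] E g → f ~[ k ] g
    E-injective k {f} {g} f~g Ef~Eg = truncated equal
      where
      open SetoidReasoning R.setoid
      cancel : ∀ n x → inverse n R.* (suc n ×ᴿ x) R.≈ x
      cancel n x = begin
        inverse n R.* (suc n ×ᴿ x)   ≈⟨ ×-comm-* (suc n) _ _ ⟩
        suc n ×ᴿ (inverse n R.* x)   ≈⟨ ×-assoc-* (suc n) _ _ ⟨
        (suc n ×ᴿ inverse n) R.* x   ≈⟨ R.*-congʳ (inverse-suc n) ⟩
        R.1# R.* x                   ≈⟨ R.*-identityˡ x ⟩
        x                            ∎
      equal : ∀ e → Vec.sum e ℕ.< k → f e R.≈ g e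
      equal e e<k with Vec.sum e in eq | at Ef~Eg e
      ... | zero  | _  = at f~g e (ℕ.s≤s (ℕ.≤-reflexive eq))
      ... | suc n | Ee = R.trans (R.sym (cancel n (f e))) (R.trans (R.*-congˡ (Ee e<k)) (cancel n (g e)))

    filteredDifferentialRing : FilteredDifferentialRing c ℓ
    filteredDifferentialRing = record
      { commutativeRing     = seriesCommutativeRing
      ; _~[_]_              = _~[_]_
      ; ~-isCommutativeRing = ~-isCommutativeRing
      ; ≈⇒~                 = ≈⇒~
      ; ~-weaken            = ~-weaken
      ; ~-zero              = ~-zero
      ; ~-shift             = ~-shift
      ; E                   = E
      ; E-~                 = E-~
      ; E-cong              = E-cong
      ; E-~-zero            = E-~-zero
      ; E-+                 = E-+
      ; E-*                 = E-*
      ; E-1                 = E-1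
      ; E-injective         = E-injective
      }

-- Reciprocals and factorials in ℚ

fromℚᵘ-homo-+ : ∀ p q → fromℚᵘ (p ℚᵘ.+ q) ≡ fromℚᵘ p ℚ.+ fromℚᵘ q
fromℚᵘ-homo-+ p q = ℚ.toℚᵘ-injective (ℚᵘ.≃-trans (ℚ.toℚᵘ-fromℚᵘ (p ℚᵘ.+ q)) (ℚᵘ.≃-sym
  (ℚᵘ.≃-trans (ℚ.toℚᵘ-homo-+ (fromℚᵘ p) (fromℚᵘ q)) (ℚᵘ.+-cong (ℚ.toℚᵘ-fromℚᵘ p) (ℚ.toℚᵘ-fromℚᵘ q)))))

fromℚᵘ-homo-* : ∀ p q → fromℚᵘ (p ℚᵘ.* q) ≡ fromℚᵘ p ℚ.* fromℚᵘ q
fromℚᵘ-homo-* p q = ℚ.toℚᵘ-injective (ℚᵘ.≃-trans (ℚ.toℚᵘ-fromℚᵘ (p ℚᵘ.* q)) (ℚᵘ.≃-sym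
  (ℚᵘ.≃-trans (ℚ.toℚᵘ-homo-* (fromℚᵘ p) (fromℚᵘ q)) (ℚᵘ.*-cong (ℚ.toℚᵘ-fromℚᵘ p) (ℚ.toℚᵘ-fromℚᵘ q)))))

-- Reduction to lowest terms blocks computation on a variable n, so the equation is checked on
-- unnormalised fractions by cross-multiplication and carried over by `fromℚᵘ`.
suc/1 : ∀ n → (ℤ.+ suc n) ℚ./ 1 ≡ 1ℚ ℚ.+ (ℤ.+ n) ℚ./ 1
suc/1 n = ≡.trans (ℚ.fromℚᵘ-cong {mkℚᵘ (ℤ.+ suc n) 0} {mkℚᵘ (ℤ.+ 1) 0 ℚᵘ.+ mkℚᵘ (ℤ.+ n) 0}
    (*≡* (≡.cong (ℤ._* ℤ.1ℤ) (≡.cong₂ ℤ._+_ {ℤ.1ℤ} ≡.refl (≡.sym (ℤ.*-identityʳ (ℤ.+ n)))))))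
  (fromℚᵘ-homo-+ (mkℚᵘ (ℤ.+ 1) 0) (mkℚᵘ (ℤ.+ n) 0))

suc/1*recip : ∀ n → (ℤ.+ suc n) ℚ./ 1 ℚ.* recip (suc n) ≡ 1ℚ
suc/1*recip n = ≡.trans (≡.sym (fromℚᵘ-homo-* (mkℚᵘ (ℤ.+ suc n) 0) (mkℚᵘ (ℤ.+ 1) n)))
  (ℚ.fromℚᵘ-cong {mkℚᵘ (ℤ.+ suc n) 0 ℚᵘ.* mkℚᵘ (ℤ.+ 1) n} {mkℚᵘ (ℤ.+ 1) 0}
    (*≡* (≡.trans (ℤ.*-identityʳ _) (≡.trans (ℤ.*-identityʳ (ℤ.+ suc n)) (≡.sym
      (≡.trans (ℤ.*-identityˡ _) (≡.cong (λ m → ℤ.+ suc m) (ℕ.+-identityʳ n))))))))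

recip-* : ∀ m n .{{_ : NonZero m}} .{{_ : NonZero n}} .{{_ : NonZero (m ℕ.* n)}} →
  recip (m ℕ.* n) ≡ recip m ℚ.* recip n
recip-* (suc m) (suc n) = fromℚᵘ-homo-* (mkℚᵘ (ℤ.+ 1) m) (mkℚᵘ (ℤ.+ 1) n)

recip!-suc : ∀ n → recip (suc n !) {{suc n ℕ.!≢0}} ≡ recip (suc n) ℚ.* recip (n !) {{n ℕ.!≢0}}
recip!-suc n = recip-* (suc n) (n !) {{_}} {{n ℕ.!≢0}} {{suc n ℕ.!≢0}}

record IsℚAlgebra {c ℓ} (R : CommutativeRing c ℓ) (ι : ℚ → CommutativeRing.Carrier R) : Set ℓ where
  open CommutativeRing R
  field
    ι-0 : ι 0ℚ ≈ 0#
    ι-1 : ι 1ℚ ≈ 1#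
    ι-+ : ∀ p q → ι (p ℚ.+ q) ≈ ι p + ι q
    ι-* : ∀ p q → ι (p ℚ.* q) ≈ ι p * ι q

-- Real powers of series with constant term 1

module RealPower {c ℓ} (R : CommutativeRing c ℓ) (ι : ℚ → CommutativeRing.Carrier R) (isℚAlgebra : IsℚAlgebra R ι) (s : ℕ) where
  open IsℚAlgebra isℚAlgebra
  private module R = CommutativeRing R
  open PowerSeries R.rawRing ι s using (_^ᴿ_; binom; falling; recip!; _^_)
  open Matrices R.rawRing using (∑)
  open SemiringMult R.semiring using (×-congʳ; ×-comm-*; ×-assoc-*) renaming (_×_ to _×ᴿ_)
  open SeriesRing R ι s
  open Truncation R ι s
  open CommutativeRing seriesCommutativeRing hiding (zero)
  open SemiringMult semiring using (_×_)

  ι-ℕ : ∀ n → ι ((ℤ.+ n) ℚ./ 1) R.≈ n ×ᴿ R.1#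
  ι-ℕ zero    = ι-0
  ι-ℕ (suc n) = R.trans (R.reflexive (≡.cong ι (suc/1 n))) (R.trans (ι-+ 1ℚ _) (R.+-cong ι-1 (ι-ℕ n)))

  ×-ι : ∀ n x → n ×ᴿ x R.≈ ι ((ℤ.+ n) ℚ./ 1) R.* x
  ×-ι n x = R.trans (×-congʳ n (R.sym (R.*-identityˡ x))) (R.trans (R.sym (×-assoc-* n R.1# x)) (R.*-congʳ (R.sym (ι-ℕ n))))

  ×-recip : ∀ n → suc n ×ᴿ ι (recip (suc n)) R.≈ R.1#
  ×-recip n = R.trans (×-ι (suc n) _) (R.trans (R.sym (ι-* _ _)) (R.trans (R.reflexive (≡.cong ι (suc/1*recip n))) ι-1))

  ι-recip!-suc : ∀ n → ι (recip! (suc n)) R.≈ ι (recip (suc n)) R.* ι (recip! n)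
  ι-recip!-suc n = R.trans (R.reflexive (≡.cong ι (recip!-suc n))) (ι-* _ _)

  ×-recip! : ∀ n → suc n ×ᴿ ι (recip! (suc n)) R.≈ ι (recip! n)
  ×-recip! n = R.trans (×-congʳ (suc n) (ι-recip!-suc n)) (R.trans (R.sym (×-assoc-* (suc n) _ _))
    (R.trans (R.*-congʳ (×-recip n)) (R.*-identityˡ _)))

  binom-zero : ∀ a → binom a 0 R.≈ R.1#
  binom-zero a = R.trans (R.*-identityˡ _) ι-1

  -- This is (n + 1) binom(a, n + 1) = (a - n) binom(a, n), with the negative term moved across to
  -- fit `coeff-suc`.
  binom-suc : ∀ a n → a R.* binom a n R.≈ suc n ×ᴿ binom a (suc n) R.+ n ×ᴿ binom a n
  binom-suc a n = R.sym (begin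
    suc n ×ᴿ ((φ R.* (a R.+ R.- ν)) R.* ι (recip! (suc n))) R.+ n ×ᴿ (φ R.* r)
      ≈⟨ R.+-cong (R.trans (R.sym (×-comm-* (suc n) _ _)) (R.*-congˡ (×-recip! n))) (×-ι n _) ⟩
    (φ R.* (a R.+ R.- ν)) R.* r R.+ ν R.* (φ R.* r)
      ≈⟨ lemma φ a (R.- ν) r ν ⟩
    a R.* (φ R.* r) R.+ (R.- ν R.+ ν) R.* (φ R.* r)
      ≈⟨ R.+-congˡ (R.trans (R.*-congʳ (R.-‿inverseˡ ν)) (R.zeroˡ _)) ⟩
    a R.* (φ R.* r) R.+ R.0#
      ≈⟨ R.+-identityʳ _ ⟩
    a R.* binom a n ∎)
    where
    open SetoidReasoning R.setoid
    φ = falling a n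
    r = ι (recip! n)
    ν = ι ((ℤ.+ n) ℚ./ 1)
    open SemiringSolver R.commutativeSemiring
    lemma : ∀ φ a m r ν → (φ R.* (a R.+ m)) R.* r R.+ ν R.* (φ R.* r) R.≈ a R.* (φ R.* r) R.+ (m R.+ ν) R.* (φ R.* r)
    lemma = solve 5 (λ φ a m r ν → (φ :* (a :+ m)) :* r :+ ν :* (φ :* r) := a :* (φ :* r) :+ (m :+ ν) :* (φ :* r)) R.refl

  private
    C-binom-zero : ∀ a → C (binom a 0) ≈ 1#
    C-binom-zero a = trans (C-cong (binom-zero a)) C-1

    C-binom-suc : ∀ a n → C a * C (binom a n) ≈ suc n × C (binom a (suc n)) + n × C (binom a n)
    C-binom-suc a n = trans (sym (C-mul a (binom a n))) (trans (C-cong (binom-suc a n))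
      (trans (C-+ _ _) (+-cong (C-× (suc n) _) (C-× n _))))

    1/suc : ℕ → R.Carrier
    1/suc n = ι (recip (suc n))

    module Binomial (a : R.Carrier) = BinomialSeries.Power (filteredDifferentialRing 1/suc ×-recip)
      (C a) (C ∘ binom a) (E-C ∘ binom a) (C-binom-zero a) (C-binom-suc a)

  1+[f-1] : ∀ f → 1# + (f - 1#) ≈ f
  1+[f-1] f = trans (+-comm 1# (f - 1#)) (trans (+-assoc f (- 1#) 1#) (trans (+-congˡ {f} (-‿inverseˡ 1#)) (+-identityʳ f)))

  f-1~0 : ∀ {f} → f ~[ 1 ] 1# → f - 1# ~[ 1 ] 0#
  f-1~0 f~1 = truncated λ e e<1 → R.trans (R.+-congʳ (at f~1 e e<1)) (R.-‿inverseʳ _)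

  module _ (a : R.Carrier) where
    open Binomial a using (partialSum; partialSum-~; partialSum-cong; partialSum-zero; partialSum-*)

    private
      ∑-last : ∀ n (F : ℕ → R.Carrier) → ∑ {suc n} (F ∘ toℕ) R.≈ ∑ {n} (F ∘ toℕ) R.+ F n
      ∑-last zero    F = R.+-comm _ _
      ∑-last (suc n) F = R.trans (R.+-congˡ (∑-last n (F ∘ suc))) (R.sym (R.+-assoc _ _ _))

      partialSum-coefficient : ∀ n u e → partialSum n u e R.≈ ∑ {suc n} λ m → binom a (toℕ m) R.* (u ^ toℕ m) e
      partialSum-coefficient zero    u e = R.trans (C-* (binom a 0) 1# e) (R.sym (R.+-identityʳ _))
      partialSum-coefficient (suc n) u e = R.trans
        (R.+-cong (partialSum-coefficient n u e) (C-* (binom a (suc n)) (u ^ suc n) e))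
        (R.sym (∑-last (suc n) λ m → binom a m R.* (u ^ m) e))

      ^ᴿ-coefficient : ∀ f e → (f ^ᴿ a) e R.≈ partialSum (Vec.sum e) (f - 1#) e
      ^ᴿ-coefficient f e = R.sym (partialSum-coefficient (Vec.sum e) (f - 1#) e)

      -- The definition cuts the series at the degree of e; for degree at most n, the terms between
      -- that cutoff and n contribute nothing at e.
      ^ᴿ-~ : ∀ n {f} → f ~[ 1 ] 1# → f ^ᴿ a ~[ suc n ] partialSum n (f - 1#)
      ^ᴿ-~ n {f} f~1 = truncated λ e e≤n → R.trans (^ᴿ-coefficient f e)
        (R.sym (R.trans (R.reflexive (≡.cong (λ m → partialSum m (f - 1#) e) (≡.sym (ℕ.m∸n+n≡m (ℕ.≤-pred e≤n)))))
          (at (partialSum-~ (Vec.sum e) (n ∸ Vec.sum e) (f-1~0 f~1)) e ℕ.≤-refl)))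

    ^ᴿ-cong : ∀ {f g} → f ≈ g → f ^ᴿ a ≈ g ^ᴿ a
    ^ᴿ-cong {f} {g} f≈g e = R.trans (^ᴿ-coefficient f e)
      (R.trans (partialSum-cong (Vec.sum e) {f - 1#} {g - 1#} (+-congʳ {x = - 1#} f≈g) e) (R.sym (^ᴿ-coefficient g e)))

    1^ᴿ : 1# ^ᴿ a ≈ 1#
    1^ᴿ e = R.trans (^ᴿ-coefficient 1# e) (partialSum-zero (Vec.sum e) {1# - 1#} (-‿inverseʳ 1#) e)

    -- It suffices to argue modulo each degree n + 1, where every power may be replaced by its n-th
    -- partial sum.
    ^ᴿ-* : ∀ {f g} → f ~[ 1 ] 1# → g ~[ 1 ] 1# → (f * g) ^ᴿ a ≈ f ^ᴿ a * g ^ᴿ a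
    ^ᴿ-* {f} {g} f~1 g~1 = ~⇒≈ {(f * g) ^ᴿ a} {f ^ᴿ a * g ^ᴿ a} λ n →
      T.trans (suc n) {(f * g) ^ᴿ a} {partialSum n (f * g - 1#)} (^ᴿ-~ n {f * g} fg~1)
        (T.trans (suc n) {partialSum n (f * g - 1#)} {partialSum n (f - 1#) * partialSum n (g - 1#)}
          (partialSum-* n {f - 1#} {g - 1#} {f * g - 1#} (f-1~0 f~1) (f-1~0 g~1) (f-1~0 fg~1) f*g)
          (T.sym (suc n) {f ^ᴿ a * g ^ᴿ a}
            (T.*-cong (suc n) {f ^ᴿ a} {partialSum n (f - 1#)} {g ^ᴿ a} {partialSum n (g - 1#)} (^ᴿ-~ n f~1) (^ᴿ-~ n g~1))))
      where
      module T k = IsCommutativeRing (~-isCommutativeRing k)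
      f*g : (1# + (f - 1#)) * (1# + (g - 1#)) ≈ 1# + (f * g - 1#)
      f*g = trans {(1# + (f - 1#)) * (1# + (g - 1#))} {f * g} {1# + (f * g - 1#)}
        (*-cong {1# + (f - 1#)} {f} {1# + (g - 1#)} {g} (1+[f-1] f) (1+[f-1] g))
        (sym {1# + (f * g - 1#)} {f * g} (1+[f-1] (f * g)))
      fg~1 : f * g ~[ 1 ] 1#
      fg~1 = T.trans 1 (T.*-cong 1 f~1 g~1) (≈⇒~ 1 (*-identityˡ 1#))

-- The recursion for Q

sum-replicate-0-[]≔-1 : ∀ {k} (i : Fin k) → Vec.sum (replicate k 0 [ i ]≔ 1) ≡ 1
sum-replicate-0-[]≔-1 {suc k} zero    = ≡.cong suc (sum-replicate-0 k)
sum-replicate-0-[]≔-1         (suc i) = sum-replicate-0-[]≔-1 i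

-- A record type, so that the recursion over ℝ is compared with the general one
-- operation by operation: unfolding it would lead into the Cauchy sequences.
record Recursion {a ℓ} {K S : Set a} (_≈_ : S → S → Set ℓ) (_*_ : S → S → S) (_·_ : K → S → S) (_^_ : S → ℕ → S)
  (∑ : ∀ {n} → (Fin n → S) → S) {s : ℕ} (X : Fin s → S) (h : (Fin s → S) → S) (Q : ℕ → S) (ι : ℚ → K) (m : ℕ) : Set ℓ where
  constructor mkRecursion
  field
    recursion : Q (suc m) ≈ (ι (recip (suc m)) · ∑ λ (j : Fin (suc m)) → let k = suc (toℕ j) in
                                                   h (λ i → X i ^ k) * Q (suc m ∸ k))

module CycleIndexSeries {c ℓ} (R : CommutativeRing c ℓ) (ι : ℚ → CommutativeRing.Carrier R) (isℚAlgebra : IsℚAlgebra R ι)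
  (s : ℕ) (r : Fin s → CommutativeRing.Carrier R) where
  private module R = CommutativeRing R
  private module S = PowerSeries R.rawRing ι s
  open S using (X; _^_; _^ᴿ_; recip!; _·_; ∑; Q)
  open SeriesRing R ι s
  open Truncation R ι s
  open IsℚAlgebra isℚAlgebra using (ι-1)
  open RealPower R ι isℚAlgebra s
  open CommutativeRing seriesCommutativeRing hiding (zero)
  open SemiringSum semiring using (sum-cong-≋)

  private
    truncatedRing : CommutativeRing c ℓ
    truncatedRing = record { isCommutativeRing = ~-isCommutativeRing 1 }
    module T = CommutativeRing truncatedRing

  X-~-zero : ∀ i → X i ~[ 1 ] 0#
  X-~-zero i = truncated λ e e<1 → monomial-≢ {replicate s 0 [ i ]≔ 1} {e} λ { ≡.refl →
    ℕ.<-irrefl ≡.refl (≡.subst (ℕ._< 1) (sum-replicate-0-[]≔-1 i) e<1) }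

  X^-~-zero : ∀ i n → X i ^ suc n ~[ 1 ] 0#
  X^-~-zero i n = T.trans (T.*-congʳ {X i ^ n} (X-~-zero i)) (≈⇒~ 1 (zeroˡ (X i ^ n)))

  1-X^-~-1 : ∀ i n → 1# - X i ^ suc n ~[ 1 ] 1#
  1-X^-~-1 i n = T.trans (T.+-congˡ {1#} (T.trans (T.-‿cong (X^-~-zero i n)) (≈⇒~ 1 (RingProperties.-0#≈0# ring)))) (≈⇒~ 1 (+-identityʳ 1#))

  -- The truncated ring has the operations of the series ring and a coarser equality, in which every
  -- power of X_i with positive exponent is 0; there `characteristicDet-zero` applies.
  det-~-1 : ∀ i {n} (w : Vec ℕ n) σ →
    Determinants.characteristicDet seriesCommutativeRing (λ k → X i ^ suc (lookup w k)) σ ~[ 1 ] 1#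
  det-~-1 i w σ = CharacteristicDetAtZero.characteristicDet-zero truncatedRing (λ k → X i ^ suc (lookup w k)) σ
    (λ k → X^-~-zero i (lookup w k))

  private
    power : Fin s → S.Series → S.Series
    power i f = f ^ᴿ r i

  open CycleSums.Powers seriesCommutativeRing X power (_~[ 1 ] 1#)
    (^ᴿ-cong ∘ r) (1^ᴿ ∘ r) (^ᴿ-* ∘ r) 1-X^-~-1 det-~-1

  1/_! : ℕ → Carrier
  1/ n ! = C (ι (recip! n))

  Q≈cycleSum/! : ∀ n → Q r n ≈ 1/ n ! * cycleSum n
  -- The convention for `Q` at 0 agrees with the sum over S_0, whose only term is 1.
  Q≈cycleSum/! zero    = sym (trans (*-cong (trans (C-cong ι-1) C-1) (cycleSum≈T₀ 0)) (*-identityˡ 1#))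
  Q≈cycleSum/! (suc n) = sym (C-* (ι (recip! (suc n))) (cycleSum (suc n)))

  Q-recursion : ∀ m → Recursion S._≈_ S._*_ _·_ _^_ ∑ X (S.h r) (Q r) ι m
  Q-recursion m = mkRecursion (begin
    Q r (suc m)
      ≈⟨ Q≈cycleSum/! (suc m) ⟩
    1/ suc m ! * cycleSum (suc m)
      -- Of 1/(m + 1)!, the factor 1/(m + 1) stays outside, while 1/m! is consumed by
      -- `cycleSum-recursion`.
      ≈⟨ *-congʳ {cycleSum (suc m)} (trans (C-cong (ι-recip!-suc m)) (C-mul (ι (recip (suc m))) (ι (recip! m)))) ⟩
    (C (ι (recip (suc m))) * 1/ m !) * cycleSum (suc m)
      ≈⟨ *-assoc (C (ι (recip (suc m)))) (1/ m !) (cycleSum (suc m)) ⟩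
    C (ι (recip (suc m))) * (1/ m ! * cycleSum (suc m))
      ≈⟨ *-congˡ {C (ι (recip (suc m)))} (trans
           (cycleSum-recursion 1/_! (λ n → trans (sym (C-× (suc n) (ι (recip! (suc n))))) (C-cong (×-recip! n))) m)
           (sum-cong-≋ {suc m} λ j → *-congˡ {h (toℕ j)} (sym (Q≈cycleSum/! (m ∸ toℕ j))))) ⟩
    -- With k = j + 1, the local `h` at j carries the exponent k, and m ∸ j is `suc m ∸ k` by
    -- computation.
    C (ι (recip (suc m))) * ∑ {suc m} (λ j → h (toℕ j) * Q r (m ∸ toℕ j))
      ≈⟨ C-* (ι (recip (suc m))) _ ⟩
    ι (recip (suc m)) · ∑ {suc m} (λ j → h (toℕ j) * Q r (m ∸ toℕ j)) ∎)
    where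
    open import Relation.Binary.Reasoning.Setoid setoid

-- Constant sequences are added and multiplied termwise, so each law relates two identical
-- sequences.
ℝ-isℚAlgebra : IsℚAlgebra ℝ-commutativeRing fromℚ
ℝ-isℚAlgebra = record
  { ι-0 = refl {fromℚ 0ℚ}
  ; ι-1 = refl {fromℚ 1ℚ}
  ; ι-+ = λ p q ε 0<ε → refl {fromℚ (p ℚ.+ q)} ε 0<ε
  ; ι-* = λ p q ε 0<ε → refl {fromℚ (p ℚ.* q)} ε 0<ε
  }
  where open CommutativeRing ℝ-commutativeRing using (refl)

real-Q-recursion : ∀ s r m → Recursion (RealSeries._≈_ s) (RealSeries._*_ s) (RealSeries._·_ s) (RealSeries._^_ s)
  (RealSeries.∑ s) (RealSeries.X s) (RealSeries.h s r) (RealSeries.Q s r) fromℚ m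
real-Q-recursion = CycleIndexSeries.Q-recursion ℝ-commutativeRing fromℚ ℝ-isℚAlgebra

-- The operations are named by let-definitions because `let open RealSeries s`
-- creates fresh copies of them, and comparing nested copies with the operations
-- in real-Q-recursion unfolds the underlying Cauchy sequences.
corollary1p4 : ∀ (s : ℕ) .{{_ : NonZero s}} (r : Fin s → ℝ) (n : ℕ) .{{_ : NonZero n}} →
    let _≈_ = RealSeries._≈_ s
        _*_ = RealSeries._*_ s
        _·_ = RealSeries._·_ s
        _^_ = RealSeries._^_ s
        ∑   = RealSeries.∑ s {n}
        X   = RealSeries.X s
        h   = RealSeries.h s
        Q   = RealSeries.Q s
    in
    Q r n ≈ (fromℚ (recip n) · ∑ (λ (j : Fin n) → let k = suc (toℕ j) in
                                 h r (λ i → X i ^ k) * Q r (n ∸ k)))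
corollary1p4 s r (suc m) = Recursion.recursion (real-Q-recursion s r m)
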